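{- Let $\mathcal{A},\mathcal{B}\subseteq\mathcal{P}_\infty(\mathbb{N})$ be hereditary families with $\mathcal{A}\perp\mathcal{B}$. Assume $\mathcal{A}$ is analytic and $\mathcal{B}$ is $C$-measurable and an M-family. Then either (i) $\mathcal{A}$ is countably generated in $\mathcal{B}^\perp$, or (ii) there exists a one-to-one map $\psi:\mathbb{N}^{<\mathbb{N}}\to\mathbb{N}$ such that $\mathcal{C}\subseteq\{\psi^{ -1}(A):A\in\mathcal{A}\}$ and $\mathcal{I}_{\mathrm{wf}}\subseteq\{\psi^{ -1}(B):B\in\mathcal{B}^{\perp\perp}\}$.
   Context: $\mathcal{P}_\infty(X)$: infinite subsets of countable $X$, with the topology of $2^X$. $C$-measurable: in the smallest $\sigma$-algebra containing open sets and closed under the Souslin operation. Hereditary: closed under passing to infinite subsets. An M-family is a hereditary family $\mathcal{A}$ such that for every sequence $(A_n)_n$ in $\mathcal{A}$ there is $A\in\mathcal{A}$ with $A\setminus\bigcup_{i\ge n}A_i$ finite for every $n$. $A\perp B$ means $A\cap B$ finite; $\mathcal{A}\perp\mathcal{B}$ means pairwise; $\mathcal{A}^\perp=\{B\in\mathcal{P}_\infty(X):B\perp A\ \forall A\in\mathcal{A}\}$, $\mathcal{B}^{\perp\perp}=(\mathcal{B}^\perp)^\perp$. $\mathcal{A}$ is countably generated in $\mathcal{D}$ if there are $D_n\in\mathcal{D}$ with every $A\in\mathcal{A}$ satisfying $A\setminus D_n$ finite for some $n$. $\mathbb{N}^{<\mathbb{N}}$ is the tree of finite sequences of naturals ordered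 by end-extension $\sqsubset$. $\mathcal{C}$ is the family of infinite chains of $\mathbb{N}^{<\mathbb{N}}$ (infinite subsets linearly ordered by $\sqsubset$). $\mathrm{WF}$ is the set of downwards closed, well-founded (no infinite branch), infinite subtrees of $\mathbb{N}^{<\mathbb{N}}$, and $\mathcal{I}_{\mathrm{wf}}=\{W\in\mathcal{P}_\infty(\mathbb{N}^{<\mathbb{N}}):\exists T\in\mathrm{WF},\ W\subseteq T\}$.
   Formalization: "Countably generated in D" allows a finite or empty family of generators D_n: with a compulsory sequence the claim fails for A empty and B all infinite subsets of N, where B^⊥ is empty; for nonempty A the two readings agree. -}

module Defs where

open import Data.Bool using (Bool; true)
open import Data.List using (List; applyUpTo)
import Data.List.Membership.Propositional as List
open import Data.List.Relation.Binary.Prefix.Heterogeneous using (Prefix)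
open import Data.List.Relation.Unary.All using (All)
open import Data.Nat using (ℕ; _≤_)
open import Data.Product using (∃-syntax; Σ-syntax; _×_)
open import Data.Sum using (_⊎_)
open import Function using (_∘_)
open import Level using (0ℓ; suc)
open import Relation.Binary.PropositionalEquality using (_≡_; _≗_)
open import Relation.Nullary using (¬_)
open import Relation.Unary
  using (Pred; Empty; _∈_; _⊆_; _≐_; _∩_; _∖_; ⋃; ⋂)

------------------------------------------------------------------------
-- Subsets of a (discrete) set X, as points of the space 2^X

2^_ : Set → Set
2^ X = X → Bool

⟦_⟧ : {X : Set} → 2^ X → Pred X 0ℓ
⟦ A ⟧ x = A x ≡ true

Finite : {X : Set} → Pred X 0ℓ → Set
Finite P = ∃[ xs ] (∀ x → x ∈ P → x List.∈ xs)

Infinite : {X : Set} → Pred X 0ℓ → Set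
Infinite P = ¬ Finite P

Family : Set → Set₁
Family X = Pred (2^ X) 0ℓ

𝒫∞ : {X : Set} → Family X
𝒫∞ A = Infinite ⟦ A ⟧

------------------------------------------------------------------------
-- Topology.  X → V carries the product topology, V being discrete: the
-- functions agreeing with f on a finite list form a basic neighbourhood of f.

_≈_on_ : {X V : Set} → (X → V) → (X → V) → List X → Set
f ≈ g on xs = All (λ x → f x ≡ g x) xs

Open : {X V : Set} → Pred (X → V) 0ℓ → Set
Open U = ∀ f → f ∈ U → ∃[ xs ] (∀ g → f ≈ g on xs → g ∈ U)

Continuous : {X V Y W : Set} → ((X → V) → (Y → W)) → Set
Continuous {Y = Y} φ =
  ∀ f (ys : List Y) → ∃[ xs ] (∀ g → f ≈ g on xs → φ f ≈ φ g on ys)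

-- Either empty, or a continuous image of the Baire space ℕ^ℕ.  Points of 2^X
-- are compared extensionally, by _≗_.
Analytic : {X : Set} → Family X → Set
Analytic {X} 𝒜 =
  Empty 𝒜 ⊎
  (∃[ φ ] Continuous {ℕ} {ℕ} {X} {Bool} φ × (𝒜 ≐ λ A → ∃[ α ] A ≗ φ α))

Souslin : {X : Set} → (List ℕ → Family X) → Family X
Souslin 𝒫 = ⋃[ α ∶ (ℕ → ℕ) ] ⋂[ n ∶ ℕ ] 𝒫 (applyUpTo α n)

-- The ambient space is 𝒫∞ X: open sets are relatively open, and complements
-- are taken in 𝒫∞ X.  Families are identified when they have the same members,
-- whence the constructor resp.
data CMeasurable {X : Set} : Pred (Family X) (suc 0ℓ) where
  open-set   : ∀ {𝒰} → Open 𝒰 → CMeasurable (𝒫∞ ∩ 𝒰)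
  complement : ∀ {𝒜} → CMeasurable 𝒜 → CMeasurable (𝒫∞ ∖ 𝒜)
  union      : ∀ {𝒜 : ℕ → Family X} →
               (∀ n → CMeasurable (𝒜 n)) → CMeasurable (⋃[ n ∶ ℕ ] 𝒜 n)
  souslin    : ∀ {𝒫 : List ℕ → Family X} →
               (∀ s → CMeasurable (𝒫 s)) → CMeasurable (Souslin 𝒫)
  resp       : ∀ {𝒜 ℬ} → 𝒜 ≐ ℬ → CMeasurable 𝒜 → CMeasurable ℬ

------------------------------------------------------------------------
-- Families of infinite sets

Hereditary : {X : Set} → Family X → Set
Hereditary 𝒜 = ∀ A A′ → A ∈ 𝒜 → A′ ∈ 𝒫∞ → ⟦ A′ ⟧ ⊆ ⟦ A ⟧ → A′ ∈ 𝒜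

record MFamily {X : Set} (𝒜 : Family X) : Set where
  field
    hereditary : Hereditary 𝒜
    diagonal   : (A : ℕ → 2^ X) → (∀ n → A n ∈ 𝒜) →
                 ∃[ A∞ ] A∞ ∈ 𝒜 ×
                   (∀ n → Finite (⟦ A∞ ⟧ ∖ (λ x → ∃[ i ] n ≤ i × x ∈ ⟦ A i ⟧)))

_⊥_ : {X : Set} → 2^ X → 2^ X → Set
A ⊥ B = Finite (⟦ A ⟧ ∩ ⟦ B ⟧)

_⊥ᶠ_ : {X : Set} → Family X → Family X → Set
𝒜 ⊥ᶠ ℬ = ∀ A B → A ∈ 𝒜 → B ∈ ℬ → A ⊥ B

infix 30 _^⊥
_^⊥ : {X : Set} → Family X → Family X
𝒜 ^⊥ = 𝒫∞ ∩ λ B → ∀ A → A ∈ 𝒜 → B ⊥ A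

-- The countable family of generators D n, n ∈ J, may be finite or empty.
-- If 𝒟 is nonempty this is the same as having a sequence of generators
-- indexed by all of ℕ; if 𝒟 is empty, only the empty family is countably
-- generated in 𝒟.
_CountablyGeneratedIn_ : {X : Set} → Family X → Family X → Set
_CountablyGeneratedIn_ {X} 𝒜 𝒟 =
  Σ[ J ∈ 2^ ℕ ] Σ[ D ∈ (ℕ → 2^ X) ]
    (∀ n → n ∈ ⟦ J ⟧ → D n ∈ 𝒟) ×
    (∀ A → A ∈ 𝒜 → ∃[ n ] n ∈ ⟦ J ⟧ × Finite (⟦ A ⟧ ∖ ⟦ D n ⟧))

------------------------------------------------------------------------
-- The tree ℕ^{<ℕ}

ℕ^<ℕ : Set
ℕ^<ℕ = List ℕ

_⊑_ : ℕ^<ℕ → ℕ^<ℕ → Set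
_⊑_ = Prefix _≡_

𝒞 : Family ℕ^<ℕ
𝒞 = 𝒫∞ ∩ λ C → ∀ s t → s ∈ ⟦ C ⟧ → t ∈ ⟦ C ⟧ → s ⊑ t ⊎ t ⊑ s

record WF (S : 2^ ℕ^<ℕ) : Set where
  field
    infinite           : S ∈ 𝒫∞
    downwards-closed   : ∀ s t → s ⊑ t → t ∈ ⟦ S ⟧ → s ∈ ⟦ S ⟧
    no-infinite-branch : ∀ α → ¬ (∀ n → applyUpTo α n ∈ ⟦ S ⟧)

I-wf : Family ℕ^<ℕ
I-wf = 𝒫∞ ∩ λ W → ∃[ S ] S ∈ WF × ⟦ W ⟧ ⊆ ⟦ S ⟧

-- { ψ⁻¹(A) : A ∈ 𝒜 }
Preimages : {X Y : Set} → (X → Y) → Family Y → Family X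
Preimages ψ 𝒜 C = ∃[ A ] A ∈ 𝒜 × C ≗ A ∘ ψ

{-# OPTIONS --safe #-}

-- Write 𝒜 = { φ α : α ∈ ℕ^ℕ } with φ continuous, and call (s , E) positive if
-- the traces φ α ∩ E, with α extending s, are not countably generated in ℬ^⊥.
-- Suppose that ([] , ℕ) is positive.  The elements b of E which belong to every
-- φ α for α extending some s′ ⊐ s with (s′ , E) positive form a set outside ℬ^⊥,
-- so it contains a member of ℬ.  Choosing such s′ and b at every node of ℕ^{<ℕ}
-- gives ψ, and chains are mapped to subsets of a single φ α.
--
-- For the well-founded part it suffices that every set having finitely many
-- elements above each t ⌢ n but infinitely many above t (each infinite subset
-- of a well-founded tree contains such a fan) contains a member of ℬ after
-- applying ψ.  This is arranged at t by a Ramsey theorem for the sequences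
-- b₀ < b₁ < … with bⱼ ∈ E (q iⱼ), where q is a sequence of positive pairs: for
-- C-measurable colourings, q can be shrunk so that the colour is constant.  The
-- colour "no tail is in ℬ" is impossible because ℬ is an M-family.  Closure of
-- the Ramsey property under the Souslin operation follows Marczewski, with
-- Galvin's lemma on dense families of finite sets as the only combinatorial input.

module Submission where

open import Defs
open import Axiom.ExcludedMiddle using (ExcludedMiddle)
open import Data.Bool using (true; false)
open import Data.Empty using (⊥-elim)
open import Data.List
  using (List; []; _∷_; [_]; _++_; length; map; reverse; applyUpTo; upTo; initLast; _∷ʳ′_)
  renaming (applyDownFrom to stem)
import Data.List.Membership.Propositional as List
open import Data.List.Membership.Propositional.Properties
  using (∈-++⁺ˡ; ∈-++⁺ʳ; ∈-map⁺; ∈-upTo⁺; ∈-applyDownFrom⁺)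
open import Data.List.Properties
  using (∷-injectiveˡ; ∷-injectiveʳ; ++-assoc; ++-identityʳ; applyDownFrom-∷ʳ;
         reverse-++; reverse-involutive; reverse-injective; length-reverse; reverse-applyUpTo)
  renaming (length-applyDownFrom to length-stem; reverse-applyDownFrom to reverse-stem)
open import Data.List.Relation.Binary.Pointwise using (Pointwise-≡⇒≡; ≡⇒Pointwise-≡)
open import Data.List.Relation.Binary.Prefix.Heterogeneous using (fromView; toView)
  renaming (_++_ to _++ᵛ_)
open import Data.List.Relation.Binary.Prefix.Heterogeneous.Properties using (toPointwise)
import Data.List.Relation.Unary.All as All
open import Data.List.Relation.Unary.Any using (here; there)
open import Data.Nat
open import Data.Nat.Properties
open import Data.Product hiding (map)
open import Data.Sum as Sum using (_⊎_; inj₁; inj₂; [_,_]′)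
open import Data.Unit using (⊤; tt)
open import Function using (_∘_; id)
open import Function.Definitions using (Injective)
open import Level using (0ℓ)
open import Relation.Binary.Definitions using (tri<; tri≈; tri>)
open import Relation.Binary.PropositionalEquality hiding ([_])
open import Relation.Nullary using (¬_; Dec; yes; no; does; contradiction)
open import Relation.Unary using (Pred; _∈_; _⊆_; _∩_; _∖_; ∁)

-- Finite sets, finite sequences and their codes

bound : (xs : List ℕ) → ∃[ N ] (∀ {x} → x List.∈ xs → x < N)
bound []       = 0 , λ ()
bound (y ∷ xs) with N , xs<N ← bound xs =
  suc y ⊔ N , λ where
    (here refl)  → m≤m⊔n (suc y) N
    (there x∈xs) → ≤-trans (xs<N x∈xs) (m≤n⊔m (suc y) N)

module _ {X : Set} {P Q : Pred X 0ℓ} where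

  finite-⊆ : P ⊆ Q → Finite Q → Finite P
  finite-⊆ P⊆Q (xs , Q⊆xs) = xs , λ x x∈P → Q⊆xs x (P⊆Q x∈P)

  finite-∪ : Finite P → Finite Q → Finite (λ x → P x ⊎ Q x)
  finite-∪ (xs , P⊆xs) (ys , Q⊆ys) = xs ++ ys , λ x →
    [ (λ x∈P → ∈-++⁺ˡ (P⊆xs x x∈P)) , (λ x∈Q → ∈-++⁺ʳ xs (Q⊆ys x x∈Q)) ]′

finite-⋃< : {X : Set} {P : ℕ → Pred X 0ℓ} → (∀ n → Finite (P n)) →
            ∀ N → Finite (λ x → ∃[ n ] n < N × P n x)
finite-⋃< fin zero    = [] , λ _ ()
finite-⋃< {P = P} fin (suc N) =
  finite-⊆ last-or-earlier (finite-∪ (finite-⋃< fin N) (fin N))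
  where
  last-or-earlier : ∀ {x} → (∃[ n ] n < suc N × P n x) →
                    (∃[ n ] n < N × P n x) ⊎ P N x
  last-or-earlier (n , n<1+N , x∈P) with m≤n⇒m<n∨m≡n (s≤s⁻¹ n<1+N)
  ... | inj₁ n<N  = inj₁ (n , n<N , x∈P)
  ... | inj₂ refl = inj₂ x∈P

finite-< : ∀ {P : Pred ℕ 0ℓ} N → (∀ {x} → x ∈ P → x < N) → Finite P
finite-< N P<N = upTo N , λ x x∈P → ∈-upTo⁺ (P<N x∈P)

unbounded⇒infinite : {P : Pred ℕ 0ℓ} → (∀ N → ∃[ x ] N ≤ x × x ∈ P) → Infinite P
unbounded⇒infinite unbdd (xs , P⊆xs) with N , xs<N ← bound xs
  with x , N≤x , x∈P ← unbdd N = <⇒≱ (xs<N (P⊆xs x x∈P)) N≤x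

finite-image : {X Y : Set} {P : Pred X 0ℓ} (f : X → Y) → Finite P →
               Finite (λ y → ∃[ x ] x ∈ P × f x ≡ y)
finite-image f (xs , P⊆xs) = map f xs , λ where
  _ (x , x∈P , refl) → ∈-map⁺ f (P⊆xs x x∈P)

-- `stem α n` runs from `α (n - 1)` down to `α 0`, so lengthening a stem is consing; hence the
-- reversals wherever sequences in natural order appear.
stem-cong : ∀ n {α β : ℕ → ℕ} → (∀ {i} → i < n → α i ≡ β i) → stem α n ≡ stem β n
stem-cong zero    α≡β = refl
stem-cong (suc n) α≡β = cong₂ _∷_ (α≡β ≤-refl) (stem-cong n (α≡β ∘ m<n⇒m<1+n))

stem-injective : ∀ {n} {α β : ℕ → ℕ} → stem α n ≡ stem β n → ∀ {i} → i < n → α i ≡ β i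
stem-injective {suc n} eq i<1+n with m≤n⇒m<n∨m≡n (s≤s⁻¹ i<1+n)
... | inj₁ i<n  = stem-injective (∷-injectiveʳ eq) i<n
... | inj₂ refl = ∷-injectiveˡ eq

stem-shorter : ∀ {m n} {α β : ℕ → ℕ} → m ≤ n → stem α n ≡ stem β n → stem α m ≡ stem β m
stem-shorter m≤n eq = stem-cong _ λ i<m → stem-injective eq (<-≤-trans i<m m≤n)

infixr 5 _◂_
_◂_ : ℕ → (ℕ → ℕ) → (ℕ → ℕ)
(b ◂ y) zero    = b
(b ◂ y) (suc j) = y j

prepend : List ℕ → (ℕ → ℕ) → (ℕ → ℕ)
prepend []      y = y
prepend (b ∷ a) y = prepend a (b ◂ y)

stem-prepend : ∀ a y j → stem (prepend a y) (j + length a) ≡ stem y j ++ a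
stem-prepend []      y j rewrite +-identityʳ j = sym (++-identityʳ (stem y j))
stem-prepend (b ∷ a) y j rewrite +-suc j (length a) = begin
  stem (prepend a (b ◂ y)) (suc j + length a) ≡⟨ stem-prepend a (b ◂ y) (suc j) ⟩
  stem (b ◂ y) (suc j) ++ a                   ≡⟨ cong (_++ a) (applyDownFrom-∷ʳ (b ◂ y) j) ⟨
  (stem y j ++ [ b ]) ++ a                    ≡⟨ ++-assoc (stem y j) [ b ] a ⟩
  stem y j ++ b ∷ a                           ∎
  where open ≡-Reasoning

prepend-lookup : ∀ a y j → prepend a y (j + length a) ≡ y j
prepend-lookup a y j = ∷-injectiveˡ (stem-prepend a y (suc j))

next : List ℕ → ℕ
next []      = 0
next (b ∷ _) = suc b

-- The subsets of the first `n` numbers as decreasing lists. There are finitely many, so one stage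
-- of a fusion can treat them all.
stems : ℕ → List (List ℕ)
stems zero    = [ [] ]
stems (suc n) = stems n ++ map (n ∷_) (stems n)

-- Equivalently, a is strictly decreasing.
Valid : List ℕ → Set
Valid a = a List.∈ stems (next a)

stems-mono : ∀ {m n a} → m ≤′ n → a List.∈ stems m → a List.∈ stems n
stems-mono ≤′-refl       a∈ = a∈
stems-mono (≤′-step m≤n) a∈ = ∈-++⁺ˡ (stems-mono m≤n a∈)

valid-∷ : ∀ {a b} → next a ≤ b → Valid a → Valid (b ∷ a)
valid-∷ {b = b} a≤b va = ∈-++⁺ʳ (stems b) (∈-map⁺ (b ∷_) (stems-mono (≤⇒≤′ a≤b) va))

-- Injective because pair c n lies between (c + n)² and (c + n + 1)².
pair : ℕ → ℕ → ℕ
pair c n = (c + n) * (c + n) + c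

pair-<-mono : ∀ {c n c′ n′} → c + n < c′ + n′ → pair c n < pair c′ n′
pair-<-mono {c} {n} {c′} {n′} s<s′ = begin-strict
  s * s + c      ≤⟨ +-monoʳ-≤ (s * s) (m≤m+n c n) ⟩
  s * s + s      ≡⟨ +-comm (s * s) s ⟩
  suc s * s      <⟨ *-monoʳ-< (suc s) (n<1+n s) ⟩
  suc s * suc s  ≤⟨ *-mono-≤ s<s′ s<s′ ⟩
  s′ * s′        ≤⟨ m≤m+n (s′ * s′) c′ ⟩
  s′ * s′ + c′   ∎
  where
  open ≤-Reasoning
  s  = c + n
  s′ = c′ + n′

pair-injective : ∀ {c n c′ n′} → pair c n ≡ pair c′ n′ → c ≡ c′ × n ≡ n′
pair-injective {c} {n} {c′} {n′} eq with <-cmp (c + n) (c′ + n′)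
... | tri< s<s′ _ _ = contradiction eq (<⇒≢ (pair-<-mono {c} {n} {c′} {n′} s<s′))
... | tri> _ _ s>s′ = contradiction (sym eq) (<⇒≢ (pair-<-mono {c′} {n′} {c} {n} s>s′))
... | tri≈ _ s≡s′ _
  with refl ← +-cancelˡ-≡ ((c′ + n′) * (c′ + n′)) c c′
                (subst (λ s → s * s + c ≡ pair c′ n′) s≡s′ eq)
  = refl , +-cancelˡ-≡ c n n′ s≡s′

code : List ℕ → ℕ
code []      = 0
code (n ∷ r) = suc (pair (code r) n)

code-injective : Injective _≡_ _≡_ code
code-injective {[]}    {[]}      eq = refl
code-injective {n ∷ r} {n′ ∷ r′} eq
  with r≡ , n≡ ← pair-injective {code r} {n} {code r′} {n′} (suc-injective eq)
  = cong₂ _∷_ n≡ (code-injective r≡)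

code-<-∷ : ∀ n r → code r < code (n ∷ r)
code-<-∷ n r = s≤s (m≤n+m (code r) _)

n≤code-∷ : ∀ n r → n ≤ code (n ∷ r)
n≤code-∷ n r = begin
  n                          ≤⟨ m≤n+m n (code r) ⟩
  s                          ≤⟨ n≤n*n s ⟩
  s * s                      ≤⟨ m≤m+n (s * s) (code r) ⟩
  pair (code r) n            ≤⟨ n≤1+n _ ⟩
  code (n ∷ r)               ∎
  where
  open ≤-Reasoning
  s = code r + n
  n≤n*n : ∀ n → n ≤ n * n
  n≤n*n zero    = z≤n
  n≤n*n (suc n) = m≤m*n (suc n) (suc n)

code-≤-++ : ∀ u r → code r ≤ code (u ++ r)
code-≤-++ []      r = ≤-refl
code-≤-++ (n ∷ u) r = ≤-trans (code-≤-++ u r) (<⇒≤ (code-<-∷ n (u ++ r)))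

-- Consequences of excluded middle

module Classical (em : ExcludedMiddle 0ℓ) where

  dne : {A : Set} → ¬ ¬ A → A
  dne {A} ¬¬a with em {A}
  ... | yes a = a
  ... | no ¬a = contradiction ¬a ¬¬a

  enum : ℕ → List ℕ
  enum n with em {∃[ r ] code r ≡ n}
  ... | yes (r , _) = r
  ... | no _        = []

  enum-code : ∀ r → enum (code r) ≡ r
  enum-code r with em {∃[ r′ ] code r′ ≡ code r}
  ... | yes (r′ , eq) = code-injective eq
  ... | no ∄          = contradiction (r , refl) ∄

  opaque

    ⌊_⌋ : {X : Set} → Pred X 0ℓ → 2^ X
    ⌊ P ⌋ x = does (em {P x})

    ∈⌊⌋⁺ : {X : Set} {P : Pred X 0ℓ} → P ⊆ ⟦ ⌊ P ⌋ ⟧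
    ∈⌊⌋⁺ {P = P} {x} x∈P with em {P x}
    ... | yes _  = refl
    ... | no x∉P = contradiction x∈P x∉P

    ∈⌊⌋⁻ : {X : Set} {P : Pred X 0ℓ} → ⟦ ⌊ P ⌋ ⟧ ⊆ P
    ∈⌊⌋⁻ {P = P} {x} x∈ with em {P x}
    ∈⌊⌋⁻ refl | yes x∈P = x∈P

  infinite⇒unbounded : {P : Pred ℕ 0ℓ} → Infinite P → ∀ N → ∃[ x ] N ≤ x × x ∈ P
  infinite⇒unbounded {P} inf N = dne λ ∄ → inf (finite-< N λ {x} x∈P →
    ≰⇒> λ N≤x → ∄ (x , N≤x , x∈P))

  infinite-image : {X Y : Set} {P : Pred X 0ℓ} {f : X → Y} → Injective _≡_ _≡_ f →
                   Infinite P → Infinite (λ y → ∃[ x ] x ∈ P × f x ≡ y)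
  infinite-image {X} {Y} {P} {f} f-inj inf (ys , f[P]⊆ys) =
    inf (finite-⊆ (λ {x} x∈P → f[P]⊆ys (f x) (x , x∈P , refl)) (preimage ys))
    where
    preimage : ∀ ys → Finite (λ x → f x List.∈ ys)
    preimage []       = [] , λ _ ()
    preimage (y ∷ ys) with xs , ⊆xs ← preimage ys | em {∃[ x ] f x ≡ y}
    ... | no ∄           = xs , λ where
          x (here eq)  → contradiction (x , eq) ∄
          x (there x∈) → ⊆xs x x∈
    ... | yes (z , refl) = z ∷ xs , λ where
          x (here eq)  → here (f-inj eq)
          x (there x∈) → there (⊆xs x x∈)

⟦⟧-ext : {X Y : Set} (A : 2^ X) (B : 2^ Y) {x : X} {y : Y} →
         (x ∈ ⟦ A ⟧ → y ∈ ⟦ B ⟧) → (y ∈ ⟦ B ⟧ → x ∈ ⟦ A ⟧) → A x ≡ B y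
⟦⟧-ext A B {x} {y} f g with A x | B y
... | true  | true  = refl
... | true  | false = sym (f refl)
... | false | true  = g refl
... | false | false = refl

-- A Ramsey theorem for sequences of positive conditions

-- The Ramsey argument sees positive pairs only through this interface. `split` expresses that one
-- piece of any two-piece partition stays positive.
record Conditions : Set₁ where
  infix 4 _≼_
  field
    P       : Set
    _≼_     : P → P → Set
    ≼-refl  : ∀ {p} → p ≼ p
    ≼-trans : ∀ {p q r} → p ≼ q → q ≼ r → p ≼ r
    E       : P → Pred ℕ 0ℓ
    E-mono  : ∀ {p q} → p ≼ q → E p ⊆ E q
    split   : ∀ p (R : Pred ℕ 0ℓ) → ∃[ p′ ] p′ ≼ p × (E p′ ⊆ R ⊎ E p′ ⊆ ∁ R)

module Ramsey (em : ExcludedMiddle 0ℓ) (conditions : Conditions) where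

  open Conditions conditions
  open Classical em

  Seq : Set
  Seq = ℕ → P

  infix 4 _≤[_]_
  -- Indices below `k` are left unconstrained, and `i ≤ j` keeps late entries late, as the bound on
  -- indices in `Steps` requires.
  _≤[_]_ : Seq → ℕ → Seq → Set
  q′ ≤[ k ] q = ∀ i → k ≤ i → ∃[ j ] i ≤ j × q′ i ≼ q j

  ≤[]-refl : ∀ {k q} → q ≤[ k ] q
  ≤[]-refl i _ = i , ≤-refl , ≼-refl

  ≤[]-trans : ∀ {k q r s} → q ≤[ k ] r → r ≤[ k ] s → q ≤[ k ] s
  ≤[]-trans q≤r r≤s i k≤i with j , i≤j , qi≼rj ← q≤r i k≤i
    with l , j≤l , rj≼sl ← r≤s j (≤-trans k≤i i≤j)
    = l , ≤-trans i≤j j≤l , ≼-trans qi≼rj rj≼sl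

  ≤[]-weaken : ∀ {k l q r} → k ≤ l → q ≤[ k ] r → q ≤[ l ] r
  ≤[]-weaken k≤l q≤r i l≤i = q≤r i (≤-trans k≤l l≤i)

  -- The numbers which may follow a stem a with next a = k.  As only indices i ≥ k
  -- are used, only finitely many stems have to be treated before fixing q i.
  Steps : Seq → ℕ → Pred ℕ 0ℓ
  Steps q k b = k ≤ b × ∃[ i ] k ≤ i × b ∈ E (q i)

  Steps-mono : ∀ {k l q r} → k ≤ l → q ≤[ k ] r → Steps q l ⊆ Steps r l
  Steps-mono k≤l q≤r (l≤b , i , l≤i , b∈) with j , i≤j , qi≼rj ← q≤r i (≤-trans k≤l l≤i)
    = l≤b , j , ≤-trans l≤i i≤j , E-mono qi≼rj b∈

  data Ext (q : Seq) : List ℕ → List ℕ → Set where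
    done : ∀ {a} → Ext q a a
    step : ∀ {a b c} → b ∈ Steps q (next a) → Ext q (b ∷ a) c → Ext q a c

  ext-snoc : ∀ {q a c b} → Ext q a c → b ∈ Steps q (next c) → Ext q a (b ∷ c)
  ext-snoc done       b∈ = step b∈ done
  ext-snoc (step x e) b∈ = step x (ext-snoc e b∈)

  ext-trans : ∀ {q a b c} → Ext q a b → Ext q b c → Ext q a c
  ext-trans done       f = f
  ext-trans (step x e) f = step x (ext-trans e f)

  ext-≤ : ∀ {q a c} → Ext q a c → next a ≤ next c
  ext-≤ done             = ≤-refl
  ext-≤ (step (k≤b , _) e) = ≤-trans (m≤n⇒m≤1+n k≤b) (ext-≤ e)

  ext-valid : ∀ {q a c} → Ext q a c → Valid a → Valid c
  ext-valid done               va = va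
  ext-valid (step (k≤b , _) e) va = ext-valid e (valid-∷ k≤b va)

  ext-mono : ∀ {q r a c} → q ≤[ next a ] r → Ext q a c → Ext r a c
  ext-mono q≤r done                 = done
  ext-mono q≤r (step b∈@(k≤b , _) e) =
    step (Steps-mono ≤-refl q≤r b∈) (ext-mono (≤[]-weaken (m≤n⇒m≤1+n k≤b) q≤r) e)

  infix 4 _∈⟨_,_⟩
  -- The analogue of an Ellentuck neighbourhood.
  _∈⟨_,_⟩ : (ℕ → ℕ) → List ℕ → Seq → Set
  Y ∈⟨ a , q ⟩ = stem Y (length a) ≡ a ×
                 (∀ j → length a ≤ j → Y j ∈ Steps q (next (stem Y j)))

  ∈-path : ∀ {Y a q j} → Y ∈⟨ a , q ⟩ → length a ≤ j → Ext q a (stem Y j)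
  ∈-path {Y} {a} {q} (eq , Y∈) a≤j = go (≤⇒≤′ a≤j)
    where
    go : ∀ {j} → length a ≤′ j → Ext q a (stem Y j)
    go (≤′-reflexive refl) = subst (Ext q a) (sym eq) done
    go (≤′-step a≤j)       = ext-snoc (go a≤j) (Y∈ _ (≤′⇒≤ a≤j))

  ∈-stem : ∀ {Y a q m} → Y ∈⟨ a , q ⟩ → length a ≤ m → Y ∈⟨ stem Y m , q ⟩
  ∈-stem {Y} {m = m} (_ , Y∈) a≤m rewrite length-stem Y m =
    refl , λ j m≤j → Y∈ j (≤-trans a≤m m≤j)

  ∈-shrink : ∀ {Y a q r} → q ≤[ next a ] r → Y ∈⟨ a , q ⟩ → Y ∈⟨ a , r ⟩
  ∈-shrink q≤r Y∈⟨⟩@(eq , Y∈) =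
    eq , λ j a≤j → Steps-mono (ext-≤ (∈-path Y∈⟨⟩ a≤j)) q≤r (Y∈ j a≤j)

  ∈-ext : ∀ {Y a c q} → Ext q a c → Y ∈⟨ c , q ⟩ → Y ∈⟨ a , q ⟩
  ∈-ext done Y∈⟨⟩ = Y∈⟨⟩
  ∈-ext {Y} {a} {q = q} (step {b = b} b∈ e) Y∈⟨⟩ with eq , Y∈ ← ∈-ext e Y∈⟨⟩ =
    ∷-injectiveʳ eq , λ j a≤j → case j (m≤n⇒m<n∨m≡n a≤j)
    where
    case : ∀ j → length a < j ⊎ length a ≡ j → Y j ∈ Steps q (next (stem Y j))
    case j (inj₁ a<j)  = Y∈ j a<j
    case j (inj₂ refl) =
      subst₂ (λ y s → y ∈ Steps q (next s)) (sym (∷-injectiveˡ eq)) (sym (∷-injectiveʳ eq)) b∈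

  ∈-below : ∀ {Y a c q r} → Ext r a c → q ≤[ next c ] r → Y ∈⟨ c , q ⟩ → Y ∈⟨ a , r ⟩
  ∈-below e q≤r = ∈-ext e ∘ ∈-shrink q≤r

  ∈-unbounded : ∀ {Y a q} → Y ∈⟨ a , q ⟩ → ∀ n → n ≤ next (stem Y (n + length a))
  ∈-unbounded         Y∈⟨⟩ zero    = z≤n
  ∈-unbounded {a = a} Y∈⟨⟩ (suc n) =
    s≤s (≤-trans (∈-unbounded Y∈⟨⟩ n) (proj₁ (proj₂ Y∈⟨⟩ _ (m≤n+m (length a) n))))

  -- Each entry is picked past the one before, so the sequence increases and every entry is an
  -- allowed step.
  thread : ∀ {a q} {R : Pred ℕ 0ℓ} → (∀ k → ∃[ b ] b ∈ Steps q k × b ∈ R) →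
           ∃[ y ] (∀ j → y j ∈ R) × (∀ j → j ≤ y j) × prepend a y ∈⟨ a , q ⟩
  thread {a} {q} {R} pick = y , y∈R , j≤y , stem-prepend a y 0 , prepend∈
    where
    y : ℕ → ℕ
    y zero    = proj₁ (pick (next a))
    y (suc j) = proj₁ (pick (suc (y j)))

    y∈R : ∀ j → y j ∈ R
    y∈R zero    = proj₂ (proj₂ (pick (next a)))
    y∈R (suc j) = proj₂ (proj₂ (pick (suc (y j))))

    y∈Steps : ∀ j → y j ∈ Steps q (next (stem y j ++ a))
    y∈Steps zero    = proj₁ (proj₂ (pick (next a)))
    y∈Steps (suc j) = proj₁ (proj₂ (pick (suc (y j))))

    j≤y : ∀ j → j ≤ y j
    j≤y zero    = z≤n
    j≤y (suc j) = ≤-trans (s≤s (j≤y j)) (proj₁ (y∈Steps (suc j)))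

    prepend∈ : ∀ j → length a ≤ j → prepend a y j ∈ Steps q (next (stem (prepend a y) j))
    prepend∈ j a≤j with i ← j ∸ length a | refl ← sym (m∸n+n≡m a≤j)
      rewrite prepend-lookup a y i | stem-prepend a y i = y∈Steps i

  -- Closed and dense properties, and fusion

  Property : Set₁
  Property = List ℕ → Seq → Set

  -- Pairs are ordered like Mathias conditions: `(c , q)` is below `(a , r)` if `c` extends `a` by
  -- steps of `r` and `q` shrinks `r` from `next c` on. `Closed` means downward closed in this
  -- order.
  Closed : Property → Set
  Closed Δ = ∀ {a c q r} → Ext r a c → q ≤[ next c ] r → Δ a r → Δ c q

  Meets : Property → Property
  Meets Δ a r = ∃[ c ] ∃[ q ] Ext r a c × q ≤[ next c ] r × Δ c q

  Dense : Property → Set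
  Dense Δ = ∀ {a} → Valid a → ∀ q → Meets Δ a q

  meets-below : ∀ {Δ a c q r} → Ext r a c → q ≤[ next c ] r → Meets Δ c q → Meets Δ a r
  meets-below e q≤r (c′ , q′ , e′ , q′≤q , δ) =
    c′ , q′ , ext-trans e (ext-mono q≤r e′) ,
    ≤[]-trans q′≤q (≤[]-weaken (ext-≤ e′) q≤r) , δ

  opaque

    -- Stage n treats the finitely many valid stems a with next a = n, changing
    -- q only from n on.
    fusion : (Φ : Property) →
             (∀ {a q r} → q ≤[ next a ] r → Φ a r → Φ a q) →
             (∀ {a} → Valid a → ∀ r → ∃[ q ] q ≤[ next a ] r × Φ a q) →
             ∀ r → ∃[ q ] q ≤[ 0 ] r × (∀ {a} → Valid a → Φ a q)
    fusion Φ mono pure r = Q∞ , ≤[]-trans (Q∞≤ 0) (Q≤ 0) , λ {a} va →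
      mono (Q∞≤ (next a)) (proj₂ (proj₂ (stage (next a) (Q (next a)))) va refl)
      where
      treat : ∀ n as r → ∃[ q ] q ≤[ n ] r × (∀ {a} → a List.∈ as → Valid a → next a ≡ n → Φ a q)
      treat n []       r = r , ≤[]-refl , λ ()
      treat n (a ∷ as) r
        with q , q≤r , φ ← treat n as r
        with em {Valid a × next a ≡ n}
      ... | no ¬va = q , q≤r , λ where
            (here refl) va eq → contradiction (va , eq) ¬va
            (there a∈)        → φ a∈
      ... | yes (va , refl) with q′ , q′≤q , φ′ ← pure va q =
            q′ , ≤[]-trans q′≤q q≤r , λ where
              (here refl) _ _    → φ′
              (there a∈)  va′ eq → mono (subst (q′ ≤[_] q) (sym eq) q′≤q) (φ a∈ va′ eq)

      stage : ∀ n r → ∃[ q ] q ≤[ n ] r × (∀ {a} → Valid a → next a ≡ n → Φ a q)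
      stage n r with q , q≤r , φ ← treat n (stems n) r =
        q , q≤r , λ {a} va eq → φ (subst (λ k → a List.∈ stems k) eq va) va eq

      Q : ℕ → Seq
      Q zero    = r
      Q (suc n) = proj₁ (stage n (Q n))

      Q≤ : ∀ n → Q (suc n) ≤[ n ] Q n
      Q≤ n = proj₁ (proj₂ (stage n (Q n)))

      Q-chain : ∀ {m n} → n ≤′ m → Q (suc m) ≤[ m ] Q (suc n)
      Q-chain ≤′-refl               = ≤[]-refl
      Q-chain {suc m} (≤′-step n≤m) =
        ≤[]-trans (Q≤ (suc m)) (≤[]-weaken (n≤1+n m) (Q-chain n≤m))

      -- Stage `i` is the last one that constrains index `i`, so the limit reads this index off
      -- right after it.
      Q∞ : Seq
      Q∞ i = Q (suc i) i

      Q∞≤ : ∀ n → Q∞ ≤[ n ] Q (suc n)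
      Q∞≤ n i n≤i = Q-chain (≤⇒≤′ n≤i) i ≤-refl

    -- Split every entry. If from some index on all choices lie in `∁ R`, shift past that index;
    -- otherwise choices inside `R` occur arbitrarily late, and only these are kept.
    split-seq : ∀ r (R : Pred ℕ 0ℓ) →
                ∃[ q ] q ≤[ 0 ] r × ((∀ {k} → Steps q k ⊆ R) ⊎ (∀ {k} → Steps q k ⊆ ∁ R))
    split-seq r R with em {∃[ k ] (∀ i → k ≤ i → E (proj₁ (split (r i) R)) ⊆ ∁ R)}
    ... | yes (k , late) =
          (λ i → proj₁ (split (r (k + i)) R)) ,
          (λ i _ → k + i , m≤n+m i k , proj₁ (proj₂ (split (r (k + i)) R))) ,
          inj₂ (λ (_ , i , _ , b∈) → late (k + i) (m≤m+n k i) b∈)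
    ... | no ∄ =
          (λ i → proj₁ (split (r (proj₁ (often i))) R)) ,
          (λ i _ → proj₁ (often i) , proj₁ (proj₂ (often i)) ,
                   proj₁ (proj₂ (split (r (proj₁ (often i))) R))) ,
          inj₁ (λ (_ , i , _ , b∈) → proj₂ (proj₂ (often i)) b∈)
      where
      often : ∀ k → ∃[ i ] k ≤ i × E (proj₁ (split (r i) R)) ⊆ R
      often k = dne λ ∄i → ∄ (k , λ i k≤i →
        [ (λ left → contradiction (i , k≤i , left) ∄i) , id ]′ (proj₂ (proj₂ (split (r i) R))))

  -- Galvin's lemma

  Accepts : Property → Property
  Accepts Δ a q = ∀ Y → Y ∈⟨ a , q ⟩ → ∃[ m ] length a ≤ m × Δ (stem Y m) q

  module _ {Δ : Property} (closed : Closed Δ) where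

    Rejects : Property
    Rejects a r = ∀ {q} → q ≤[ next a ] r → ¬ Accepts Δ a q

    accepts-mono : ∀ {a q r} → q ≤[ next a ] r → Accepts Δ a r → Accepts Δ a q
    accepts-mono q≤r acc Y Y∈⟨⟩ with m , a≤m , δ ← acc Y (∈-shrink q≤r Y∈⟨⟩) =
      m , a≤m , closed done (≤[]-weaken (ext-≤ (∈-path Y∈⟨⟩ a≤m)) q≤r) δ

    rejects-mono : ∀ {a q r} → q ≤[ next a ] r → Rejects a r → Rejects a q
    rejects-mono q≤r rej q′≤q = rej (≤[]-trans q′≤q q≤r)

    decide : ∀ a r → ∃[ q ] q ≤[ next a ] r × (Accepts Δ a q ⊎ Rejects a q)
    decide a r with em {∃[ q ] q ≤[ next a ] r × Accepts Δ a q}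
    ... | yes (q , q≤r , acc) = q , q≤r , inj₁ acc
    ... | no ∄                = r , ≤[]-refl , inj₂ (λ q≤r acc → ∄ (_ , q≤r , acc))

    Homogeneous : Property
    Homogeneous a q = (∀ {b} → b ∈ Steps q (next a) → Accepts Δ (b ∷ a) q) ⊎
                      (∀ {b} → b ∈ Steps q (next a) → Rejects (b ∷ a) q)

    homogeneous-mono : ∀ {a q r} → q ≤[ next a ] r → Homogeneous a r → Homogeneous a q
    homogeneous-mono q≤r = Sum.map
      (λ f b∈ → accepts-mono (≤[]-weaken (m≤n⇒m≤1+n (proj₁ b∈)) q≤r) (f (Steps-mono ≤-refl q≤r b∈)))
      (λ f b∈ → rejects-mono (≤[]-weaken (m≤n⇒m≤1+n (proj₁ b∈)) q≤r) (f (Steps-mono ≤-refl q≤r b∈)))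

    -- A fusion first decides all valid stems at once; `split-seq` then makes the one-step
    -- extensions of `a` agree.
    homogenize : ∀ {a} → Valid a → ∀ r → ∃[ q ] q ≤[ next a ] r × Homogeneous a q
    homogenize {a} va r
      with q , q≤r , decided ←
             fusion (λ a q → Accepts Δ a q ⊎ Rejects a q)
                    (λ q≤r → Sum.map (accepts-mono q≤r) (rejects-mono q≤r))
                    (λ {a} _ → decide a) r
      with q′ , q′≤q , side ← split-seq q (λ b → Accepts Δ (b ∷ a) q)
      = q′ , ≤[]-weaken z≤n (≤[]-trans q′≤q q≤r) , Sum.map
          (λ f b∈ → accepts-mono (≤[]-weaken z≤n q′≤q) (f b∈))
          (λ f b∈ → rejects-mono (≤[]-weaken z≤n q′≤q)
                      ([ (λ acc → contradiction acc (f b∈)) , id ]′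
                         (decided (valid-∷ (proj₁ b∈) va))))
          side

    accepts-∷ : ∀ {a q} → (∀ {b} → b ∈ Steps q (next a) → Accepts Δ (b ∷ a) q) → Accepts Δ a q
    accepts-∷ {a} {q} f Y Y∈⟨⟩@(eq , Y∈)
      with m , a<m , δ ← f (subst (λ s → Y (length a) ∈ Steps q (next s)) eq (Y∈ _ ≤-refl)) Y
                           (subst (λ s → Y ∈⟨ Y (length a) ∷ s , q ⟩) eq
                             (∈-stem {m = suc (length a)} Y∈⟨⟩ (n≤1+n _)))
      = m , <⇒≤ a<m , δ

    -- If the one-step extensions of a rejected stem all accepted, so would the stem. By homogeneity
    -- they all reject, and this repeats along the extension.
    rejects-ext : ∀ {q} → (∀ {a} → Valid a → Homogeneous a q) →
                  ∀ {a c} → Valid a → Ext q a c → Rejects a q → Rejects c q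
    rejects-ext hom va done        rej = rej
    rejects-ext {q} hom {a} {c} va (step {b = b} b∈ e) rej = go (hom va)
      where
      go : Homogeneous a q → Rejects c q
      go (inj₁ acc)  = ⊥-elim (rej ≤[]-refl (accepts-∷ acc))
      go (inj₂ rej′) = rejects-ext hom (valid-∷ (proj₁ b∈) va) e (rej′ b∈)

    -- Density gives a pair below that satisfies `Δ` and hence accepts at its own stem, although
    -- rejection would have passed on to it.
    not-rejects : Dense Δ → ∀ {a} → Valid a → ∀ q → ¬ Rejects a q
    not-rejects dense {a} va q rej =
      let q′ , q′≤q , hom = fusion Homogeneous homogeneous-mono homogenize q
          c , q″ , e , q″≤q′ , δ = dense va q′
      in rejects-ext hom va e (rejects-mono (≤[]-weaken z≤n q′≤q) rej) q″≤q′
           (λ _ (eq , _) → length c , ≤-refl , subst (λ s → Δ s q″) (sym eq) δ)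

    opaque

      galvin : Dense Δ → ∀ {a} → Valid a → ∀ r → ∃[ q ] q ≤[ next a ] r × Accepts Δ a q
      galvin dense {a} va r =
        let q , q≤r , acc-or-rej = decide a r
        in q , q≤r , [ id , (λ rej → contradiction rej (not-rejects dense va q)) ]′ acc-or-rej

  opaque

    galvin-< : {Δ : ℕ → Property} → (∀ n → Closed (Δ n)) → (∀ n → Dense (Δ n)) →
               ∀ {a} → Valid a → ∀ r N →
               ∃[ q ] q ≤[ next a ] r × (∀ {n} → n < N → Accepts (Δ n) a q)
    galvin-< closed dense va r zero    = r , ≤[]-refl , λ ()
    galvin-< {Δ} closed dense {a} va r (suc N) =
      let q  , q≤r  , acc  = galvin-< closed dense va r N
          q′ , q′≤q , acc′ = galvin (closed N) (dense N) va q
      in q′ , ≤[]-trans q′≤q q≤r , λ n<1+N → extend q′≤q acc acc′ (m≤n⇒m<n∨m≡n (s≤s⁻¹ n<1+N))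
      where
      extend : ∀ {q q′} → q′ ≤[ next a ] q → (∀ {n} → n < N → Accepts (Δ n) a q) →
               Accepts (Δ N) a q′ → ∀ {n} → n < N ⊎ n ≡ N → Accepts (Δ n) a q′
      extend q′≤q acc acc′ {n} (inj₁ n<N) = accepts-mono (closed n) q′≤q (acc n<N)
      extend q′≤q acc acc′ (inj₂ refl)    = acc′

    -- Fusion makes each valid stem `a` accept only the first `next a` properties, but `next` grows
    -- along every sequence, so each property is reached.
    galvin-ω : {Δ : List ℕ → Property} → (∀ s → Closed (Δ s)) → (∀ s → Dense (Δ s)) →
               ∀ {a} → Valid a → ∀ r → ∃[ q ] q ≤[ next a ] r × (∀ s → Accepts (Δ s) a q)
    galvin-ω {Δ} closed dense {a} va r =
      let q , q≤r , acc = fusion AcceptsUpTo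
            (λ q≤r acc n< → accepts-mono (closed _) q≤r (acc n<))
            (λ va r → galvin-< (λ n → closed (enum n)) (λ n → dense (enum n)) va r _) r
      in q , ≤[]-weaken z≤n q≤r , accepts-all acc
      where
      AcceptsUpTo : Property
      AcceptsUpTo a q = ∀ {n} → n < next a → Accepts (Δ (enum n)) a q

      accepts-all : ∀ {q} → (∀ {a} → Valid a → AcceptsUpTo a q) → ∀ s → Accepts (Δ s) a q
      accepts-all {q} acc s Y Y∈⟨⟩ =
        let m       = suc (code s) + length a
            a≤m     = m≤n+m (length a) (suc (code s))
            n , m≤n , δ = acc (ext-valid (∈-path Y∈⟨⟩ a≤m) va)
                            (∈-unbounded Y∈⟨⟩ (suc (code s))) Y (∈-stem Y∈⟨⟩ a≤m)
        in n , ≤-trans a≤m (subst (_≤ n) (length-stem Y m) m≤n) ,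
           subst (λ s → Δ s (stem Y n) q) (enum-code s) δ

  -- Measurable colourings and the Souslin operation

  Inside Outside : Pred (ℕ → ℕ) 0ℓ → Property
  Inside  X a q = ∀ Y → Y ∈⟨ a , q ⟩ → Y ∈ X
  Outside X a q = ∀ Y → Y ∈⟨ a , q ⟩ → ¬ (Y ∈ X)

  -- The stem may be extended: this is weaker than being completely Ramsey.
  Measurable : Pred (Pred (ℕ → ℕ) 0ℓ) 0ℓ
  Measurable X = Dense (λ a q → Inside X a q ⊎ Outside X a q)

  inside-closed : ∀ {X} → Closed (Inside X)
  inside-closed e q≤r in-r Y Y∈⟨⟩ = in-r Y (∈-below e q≤r Y∈⟨⟩)

  outside-closed : ∀ {X} → Closed (Outside X)
  outside-closed e q≤r out-r Y Y∈⟨⟩ = out-r Y (∈-below e q≤r Y∈⟨⟩)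

  Positive : Pred (ℕ → ℕ) 0ℓ → Property
  Positive X a q = ¬ Meets (Outside X) a q

  positive-closed : ∀ {X} → Closed (Positive X)
  positive-closed e q≤r pos = pos ∘ meets-below e q≤r

  inside-or-outside-closed : ∀ {X} → Closed (λ a q → Inside X a q ⊎ Outside X a q)
  inside-or-outside-closed e q≤r = Sum.map (inside-closed e q≤r) (outside-closed e q≤r)

  closed-along : ∀ {Δ} → Closed Δ → ∀ {Y a q m n} → Y ∈⟨ a , q ⟩ → length a ≤ m → m ≤ n →
                 Δ (stem Y m) q → Δ (stem Y n) q
  closed-along closed {Y} {m = m} Y∈⟨⟩ a≤m m≤n = closed
    (∈-path (∈-stem Y∈⟨⟩ a≤m) (subst (_≤ _) (sym (length-stem Y m)) m≤n)) ≤[]-refl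

  module _ (X : List ℕ → Pred (ℕ → ℕ) 0ℓ) (meas : ∀ s → Measurable (X s)) where

    -- The part of the Souslin operation using only the α beginning with s.
    Branches : List ℕ → Pred (ℕ → ℕ) 0ℓ
    Branches s Y = ∃[ α ] stem α (length s) ≡ s × (∀ n → Y ∈ X (stem α n))

    branches⊆ : ∀ {s} → Branches s ⊆ X s
    branches⊆ {s} {Y} (α , eq , Y∈) = subst (λ s → Y ∈ X s) eq (Y∈ (length s))

    branches-step : ∀ {s} → Branches s ⊆ λ Y → ∃[ n ] Y ∈ Branches (n ∷ s)
    branches-step {s} (α , eq , Y∈) = α (length s) , α , cong (α (length s) ∷_) eq , Y∈

    -- What one step of a branch construction needs: `X s` is decided, and `Branches s`, unless
    -- null, passes positivity on to a definite successor.
    Refined : List ℕ → Property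
    Refined s a q = (Inside (X s) a q ⊎ Outside (X s) a q) ×
                    (Outside (Branches s) a q ⊎ ∃[ n ] Positive (Branches (n ∷ s)) a q)

    refined-closed : ∀ s → Closed (Refined s)
    refined-closed s e q≤r (in-or-out , δ) =
      inside-or-outside-closed e q≤r in-or-out ,
      Sum.map (outside-closed e q≤r) (λ (n , pos) → n , positive-closed e q≤r pos) δ

    outside-or-positive : List ℕ → Property
    outside-or-positive s a q = Outside (Branches s) a q ⊎ Positive (Branches s) a q

    outside-or-positive-closed : ∀ s → Closed (outside-or-positive s)
    outside-or-positive-closed s e q≤r =
      Sum.map (outside-closed e q≤r) (positive-closed e q≤r)

    outside-or-positive-dense : ∀ s → Dense (outside-or-positive s)
    outside-or-positive-dense s {a} va q with em {Meets (Outside (Branches s)) a q}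
    ... | yes (c , r , e , r≤q , out) = c , r , e , r≤q , inj₁ out
    ... | no pos                      = a , q , done , ≤[]-refl , inj₂ pos

    -- If no extension of (a , q) is positive for an immediate successor of s,
    -- then fusion makes all of these successors null at once.
    successors-null : ∀ {a q r s} → (∀ n → ¬ Meets (Positive (Branches (n ∷ s))) a q) →
                      r ≤[ next a ] q → (∀ t → Accepts (outside-or-positive t) a r) →
                      Outside (Branches s) a r
    successors-null {r = r} {s} none r≤q acc Y Y∈⟨⟩ Y∈ with n , Y∈n ← branches-step Y∈
      with m , a≤m , δ ← acc (n ∷ s) Y Y∈⟨⟩ with δ
    ... | inj₁ out = out Y (∈-stem Y∈⟨⟩ a≤m) Y∈n
    ... | inj₂ pos =
          let e = ∈-path Y∈⟨⟩ a≤m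
          in none n (stem Y m , r , ext-mono r≤q e , ≤[]-weaken (ext-≤ e) r≤q , pos)

    successor-positive : ∀ {a} → Valid a → ∀ q s → Positive (Branches s) a q →
                         ∃[ n ] Meets (Positive (Branches (n ∷ s))) a q
    successor-positive {a} va q s pos = dne λ ∄ →
      pos (null (λ n meets → ∄ (n , meets))
        (galvin-ω outside-or-positive-closed outside-or-positive-dense va q))
      where
      null : (∀ n → ¬ Meets (Positive (Branches (n ∷ s))) a q) →
             (∃[ r ] r ≤[ next a ] q × (∀ t → Accepts (outside-or-positive t) a r)) →
             Meets (Outside (Branches s)) a q
      null none (r , r≤q , acc) = a , r , done , r≤q , successors-null none r≤q acc

    refined-dense : ∀ s → Dense (Refined s)
    refined-dense s {a} va q =
      let c , r , e , r≤q , in-or-out = meas s va q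
      in meets-below e r≤q (refine (ext-valid e va) in-or-out em)
      where
      refine : ∀ {c r} → Valid c → Inside (X s) c r ⊎ Outside (X s) c r →
               Dec (Meets (Outside (Branches s)) c r) → Meets (Refined s) c r
      refine vc in-or-out (yes (c′ , r′ , e′ , r′≤r , out)) =
        c′ , r′ , e′ , r′≤r , inside-or-outside-closed e′ r′≤r in-or-out , inj₁ out
      refine {r = r} vc in-or-out (no pos) =
        let n , c′ , r′ , e′ , r′≤r , pos′ = successor-positive vc r s pos
        in c′ , r′ , e′ , r′≤r , inside-or-outside-closed e′ r′≤r in-or-out , inj₂ (n , pos′)

    -- Below a positive condition meeting every Refined s, each Y picks its own
    -- branch α by staying positive for all stems of α.
    positive⇒inside : ∀ {a q} → (∀ s → Accepts (Refined s) a q) →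
                      Positive (Branches []) a q → Inside (Branches []) a q
    positive⇒inside {a} {q} acc pos Y Y∈⟨⟩ =
      (λ n → proj₁ (advance (track n))) , refl , λ n →
        subst (λ s → Y ∈ X s) (stem-track n) (in-track (track n))
      where
      Track : Set
      Track = ∃[ s ] ∃[ m ] length a ≤ m × Positive (Branches s) (stem Y m) q

      refine : ((s , _) : Track) → ∃[ n ] Positive (Branches s) (stem Y n) q ×
                                   length a ≤ n × Refined s (stem Y n) q
      refine (s , m , a≤m , pos) with n , a≤n , δ ← acc s Y Y∈⟨⟩ =
        m ⊔ n ,
        closed-along positive-closed Y∈⟨⟩ a≤m (m≤m⊔n m n) pos ,
        ≤-trans a≤n (m≤n⊔m m n) ,
        closed-along (refined-closed s) Y∈⟨⟩ a≤n (m≤n⊔m m n) δ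

      outside-contra : ∀ {s m} → Positive (Branches s) (stem Y m) q →
                       ¬ Outside (Branches s) (stem Y m) q
      outside-contra pos out = pos (_ , _ , done , ≤[]-refl , out)

      advance : ((s , _) : Track) →
                ∃[ n ] ∃[ m ] length a ≤ m × Positive (Branches (n ∷ s)) (stem Y m) q
      advance t with m , pos , a≤m , _ , δ ← refine t with δ
      ... | inj₁ out        = contradiction out (outside-contra pos)
      ... | inj₂ (n , pos′) = n , m , a≤m , pos′

      in-track : ((s , _) : Track) → Y ∈ X s
      in-track t with m , pos , a≤m , in-or-out , _ ← refine t with in-or-out
      ... | inj₁ inside  = inside Y (∈-stem Y∈⟨⟩ a≤m)
      ... | inj₂ outside = contradiction (λ Y Y∈⟨⟩ → outside Y Y∈⟨⟩ ∘ branches⊆) (outside-contra pos)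

      track : ℕ → Track
      track zero    = [] , length a , ≤-refl , subst (λ s → Positive _ s q) (sym (proj₁ Y∈⟨⟩)) pos
      track (suc j) = let n , rest = advance (track j) in n ∷ proj₁ (track j) , rest

      stem-track : ∀ n → proj₁ (track n) ≡ stem (λ n → proj₁ (advance (track n))) n
      stem-track zero    = refl
      stem-track (suc n) = cong (proj₁ (advance (track n)) ∷_) (stem-track n)

    X∞ : Pred (ℕ → ℕ) 0ℓ
    X∞ Y = ∃[ α ] (∀ n → Y ∈ X (stem α n))

    opaque

      measurable-souslin : Measurable X∞
      measurable-souslin {a} va q =
        let r , r≤q , acc = galvin-ω refined-closed refined-dense va q
        in meets-below done r≤q (by-positivity r acc em)
        where
        by-positivity : ∀ r → (∀ s → Accepts (Refined s) a r) →
                        Dec (Meets (Outside (Branches [])) a r) →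
                        Meets (λ a q → Inside X∞ a q ⊎ Outside X∞ a q) a r
        by-positivity _ _ (yes (c , r′ , e , r′≤r , out)) =
          c , r′ , e , r′≤r , inj₂ (λ Y Y∈⟨⟩ (α , Y∈) → out Y Y∈⟨⟩ (α , refl , Y∈))
        by-positivity r acc (no pos) =
          a , r , done , ≤[]-refl ,
          inj₁ (λ Y Y∈⟨⟩ → let α , _ , Y∈ = positive⇒inside acc pos Y Y∈⟨⟩ in α , Y∈)

  measurable-resp : ∀ {X X′} → (∀ {a q Y} → Y ∈⟨ a , q ⟩ → Y ∈ X → Y ∈ X′) →
                    (∀ {a q Y} → Y ∈⟨ a , q ⟩ → Y ∈ X′ → Y ∈ X) →
                    Measurable X → Measurable X′
  measurable-resp X→X′ X′→X meas va q with c , r , e , r≤q , δ ← meas va q =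
    c , r , e , r≤q ,
    Sum.map (λ inside Y Y∈⟨⟩ → X→X′ Y∈⟨⟩ (inside Y Y∈⟨⟩))
            (λ outside Y Y∈⟨⟩ → outside Y Y∈⟨⟩ ∘ X′→X Y∈⟨⟩) δ

  measurable-∁ : ∀ {X} → Measurable X → Measurable (∁ X)
  measurable-∁ meas va q with c , r , e , r≤q , δ ← meas va q =
    c , r , e , r≤q ,
    [ (λ inside → inj₂ λ Y Y∈⟨⟩ Y∉X → Y∉X (inside Y Y∈⟨⟩)) , inj₁ ]′ δ

  -- A countable union is a Souslin operation whose scheme is trivial except at stems of length one.
  measurable-⋃ : {X : ℕ → Pred (ℕ → ℕ) 0ℓ} → (∀ n → Measurable (X n)) →
                 Measurable (λ Y → ∃[ n ] Y ∈ X n)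
  measurable-⋃ {X} meas = measurable-resp
    (λ _ (α , Y∈) → α 0 , Y∈ 1)
    (λ _ (n , Y∈) → (λ _ → n) , λ where
      zero          → tt
      (suc zero)    → Y∈
      (suc (suc _)) → tt)
    (measurable-souslin X′ meas′)
    where
    X′ : List ℕ → Pred (ℕ → ℕ) 0ℓ
    X′ (n ∷ []) = X n
    X′ _        = λ _ → ⊤

    meas-⊤ : Measurable (λ _ → ⊤)
    meas-⊤ {a} _ q = a , q , done , ≤[]-refl , inj₁ (λ _ _ → tt)

    meas′ : ∀ s → Measurable (X′ s)
    meas′ []          = meas-⊤
    meas′ (n ∷ [])    = meas n
    meas′ (_ ∷ _ ∷ _) = meas-⊤

  -- C-measurable families as colourings of sequences

  tail : ℕ → (ℕ → ℕ) → 2^ ℕ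
  tail k Y = ⌊ (λ n → k ≤ n × ∃[ j ] Y j ≡ n) ⌋

  tail-infinite : ∀ k {Y} → (∀ N → ∃[ j ] N ≤ Y j) → tail k Y ∈ 𝒫∞
  tail-infinite k {Y} unbdd = unbounded⇒infinite λ N →
    let j , N⊔k≤Yj = unbdd (N ⊔ k)
    in Y j , m⊔n≤o⇒m≤o N k N⊔k≤Yj , ∈⌊⌋⁺ (m⊔n≤o⇒n≤o N k N⊔k≤Yj , j , refl)

  ∈-tail-infinite : ∀ k {Y a q} → Y ∈⟨ a , q ⟩ → tail k Y ∈ 𝒫∞
  ∈-tail-infinite k {Y} {a} Y∈⟨⟩ = tail-infinite k λ N → N + length a ,
    ≤-trans (∈-unbounded Y∈⟨⟩ N) (proj₁ (proj₂ Y∈⟨⟩ _ (m≤n+m (length a) N)))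

  -- Entries after a stem are at least its `next`, so smaller members of the tail already occur in
  -- the stem.
  tail-local : ∀ {k Y Z m q x} → stem Y m ≡ stem Z m → Y ∈⟨ stem Y m , q ⟩ →
               x < next (stem Y m) → x ∈ ⟦ tail k Y ⟧ → x ∈ ⟦ tail k Z ⟧
  tail-local {m = m} eq Y∈⟨⟩ x<next x∈ with k≤x , j , refl ← ∈⌊⌋⁻ x∈ with j <? m
  ... | yes j<m = ∈⌊⌋⁺ (k≤x , j , sym (stem-injective eq j<m))
  ... | no j≮m  = contradiction x<next (≤⇒≯ (≤-trans
        (ext-≤ (∈-path Y∈⟨⟩ |s|≤j)) (proj₁ (proj₂ Y∈⟨⟩ j |s|≤j))))
    where |s|≤j = ≤-trans (≤-reflexive (length-stem _ m)) (≮⇒≥ j≮m)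

  -- Either no sequence of the neighbourhood enters `𝒰`, or one does, and a long stem of it
  -- determines the tail on the finite list that guarantees membership. The stem has to grow here,
  -- as `Measurable` allows.
  measurable-open : ∀ {𝒰 : Family ℕ} → Open 𝒰 → ∀ k → Measurable (λ Y → tail k Y ∈ 𝒰)
  measurable-open {𝒰} open-𝒰 k {a} va q with em {∃[ Y ] Y ∈⟨ a , q ⟩ × tail k Y ∈ 𝒰}
  ... | no ∄ = a , q , done , ≤[]-refl , inj₂ (λ _ Y∈⟨⟩ Y∈𝒰 → ∄ (_ , Y∈⟨⟩ , Y∈𝒰))
  ... | yes (Y , Y∈⟨⟩ , Y∈𝒰)
    with xs , near ← open-𝒰 (tail k Y) Y∈𝒰
    with N , xs<N ← bound xs
    = stem Y m , q , ∈-path Y∈⟨⟩ a≤m , ≤[]-refl , inj₁ λ Z Z∈⟨⟩ →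
        near (tail k Z) (All.tabulate λ x∈xs →
          let eq = trans (cong (stem Z) (sym (length-stem Y m))) (proj₁ Z∈⟨⟩)
              x<next = <-≤-trans (xs<N x∈xs) (∈-unbounded Y∈⟨⟩ N)
          in ⟦⟧-ext (tail k Y) (tail k Z)
               (tail-local (sym eq) (∈-stem Y∈⟨⟩ a≤m) x<next)
               (tail-local eq (subst (Z ∈⟨_, q ⟩) (sym eq) Z∈⟨⟩)
                  (subst (λ s → _ < next s) (sym eq) x<next)))
    where
    m   = N + length a
    a≤m = m≤n+m (length a) N

  -- Tails of sequences in a neighbourhood are infinite, so the relativization to `𝒫∞` changes
  -- nothing there.
  measurable-tail : ∀ {𝒳 : Family ℕ} → CMeasurable 𝒳 → ∀ k → Measurable (λ Y → tail k Y ∈ 𝒳)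
  measurable-tail (open-set open-𝒰) k = measurable-resp
    (λ Y∈⟨⟩ Y∈𝒰 → ∈-tail-infinite k Y∈⟨⟩ , Y∈𝒰) (λ _ → proj₂) (measurable-open open-𝒰 k)
  measurable-tail (complement cm) k = measurable-resp
    (λ Y∈⟨⟩ Y∉ → ∈-tail-infinite k Y∈⟨⟩ , Y∉) (λ _ → proj₂)
    (measurable-∁ (measurable-tail cm k))
  measurable-tail (union cm) k = measurable-⋃ (λ n → measurable-tail (cm n) k)
  -- `Souslin` uses initial segments in natural order, whereas stems are reversed; the scheme is
  -- reindexed accordingly.
  measurable-tail (souslin {𝒫} cm) k = measurable-resp
    (λ {_} {_} {Y} _ (α , Y∈) → α , λ n → subst (λ s → tail k Y ∈ 𝒫 s) (reverse-stem α n) (Y∈ n))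
    (λ {_} {_} {Y} _ (α , Y∈) → α , λ n → subst (λ s → tail k Y ∈ 𝒫 s) (sym (reverse-stem α n)) (Y∈ n))
    (measurable-souslin _ (λ s → measurable-tail (cm (reverse s)) k))
  measurable-tail (resp (𝒜⊆ℬ , ℬ⊆𝒜) cm) k =
    measurable-resp (λ _ → 𝒜⊆ℬ) (λ _ → ℬ⊆𝒜) (measurable-tail cm k)

-- Chains and well-founded trees

⊑⇒reverse : ∀ {s t} → s ⊑ t → ∃[ u ] reverse t ≡ u ++ reverse s
⊑⇒reverse {s} s⊑t with s≋ ++ᵛ ds ← toView s⊑t with refl ← Pointwise-≡⇒≡ s≋ =
  reverse ds , reverse-++ s ds

reverse⇒⊑ : ∀ {s t u} → reverse t ≡ u ++ reverse s → s ⊑ t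
reverse⇒⊑ {s} {t} {u} eq = subst (s ⊑_) (sym t≡) (fromView (≡⇒Pointwise-≡ refl ++ᵛ reverse u))
  where
  open ≡-Reasoning
  t≡ : t ≡ s ++ reverse u
  t≡ = begin
    t                                  ≡⟨ reverse-involutive t ⟨
    reverse (reverse t)                ≡⟨ cong reverse eq ⟩
    reverse (u ++ reverse s)           ≡⟨ reverse-++ u (reverse s) ⟩
    reverse (reverse s) ++ reverse u   ≡⟨ cong (_++ reverse u) (reverse-involutive s) ⟩
    s ++ reverse u                     ∎

module Trees (em : ExcludedMiddle 0ℓ) where

  open Classical em

  opaque

    -- A chain has at most one element of each length, so bounded lengths would make it finite.
    chain-unbounded : ∀ {C} → C ∈ 𝒞 → ∀ i → ∃[ t ] t ∈ ⟦ C ⟧ × i ≤ length t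
    chain-unbounded {C} (infinite , chain) i = dne λ ∄ →
      infinite (finite-⊆ (λ {t} t∈C → t∈C , ≰⇒> (λ i≤t → ∄ (t , t∈C , i≤t))) (short i))
      where
      same-length : ∀ {s t} → s ⊑ t → length s ≡ length t → s ≡ t
      same-length s⊑t eq = Pointwise-≡⇒≡ (toPointwise eq s⊑t)

      level : ∀ n → Finite (λ t → t ∈ ⟦ C ⟧ × length t ≡ n)
      level n with em {∃[ t ] t ∈ ⟦ C ⟧ × length t ≡ n}
      ... | no ∄               = [] , λ t t∈ → contradiction (t , t∈) ∄
      ... | yes (s , s∈C , eq) = [ s ] , λ t (t∈C , eq′) → here
            ([ (λ s⊑t → sym (same-length s⊑t (trans eq (sym eq′))))
             , (λ t⊑s → same-length t⊑s (trans eq′ (sym eq))) ]′ (chain s t s∈C t∈C))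

      short : ∀ n → Finite (λ t → t ∈ ⟦ C ⟧ × length t < n)
      short n = finite-⊆ (λ (t∈C , t<n) → _ , t<n , t∈C , refl) (finite-⋃< level n)

  Above : Pred (List ℕ) 0ℓ → List ℕ → Pred (List ℕ) 0ℓ
  Above V r w = (∃[ u ] w ≡ u ++ r) × w ∈ V

  Fanned : Pred (List ℕ) 0ℓ → List ℕ → Set
  Fanned V r = Infinite (Above V r) × (∀ n → Finite (Above V (n ∷ r)))

  opaque

    -- Otherwise every node with infinitely many elements of `V` above it has a child of the same
    -- kind, and iterating from the root yields an infinite branch of `S`.
    wf⇒fanned : ∀ {S V} → WF S → (∀ {w} → w ∈ V → reverse w ∈ ⟦ S ⟧) → Infinite V → ∃[ r ] Fanned V r
    wf⇒fanned {S} {V} wf V⊆S inf = dne λ ∄ →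
      no-infinite-branch-fanned (λ (r , inf-r) → dne λ ∄n →
        ∄ (r , inf-r , λ n → dne λ inf-n → ∄n (n , inf-n)))
      where
      Big : Set
      Big = Σ[ r ∈ List ℕ ] Infinite (Above V r)

      no-infinite-branch-fanned : ¬ (((r , _) : Big) → ∃[ n ] Infinite (Above V (n ∷ r)))
      no-infinite-branch-fanned extend = WF.no-infinite-branch wf α α-branch
        where
        ρ : ℕ → Big
        ρ zero    = [] , λ fin → inf (finite-⊆ (λ {w} w∈V → (w , sym (++-identityʳ w)) , w∈V) fin)
        ρ (suc j) = let n , inf-n = extend (ρ j) in n ∷ proj₁ (ρ j) , inf-n

        α : ℕ → ℕ
        α j = proj₁ (extend (ρ j))

        ρ-stem : ∀ j → proj₁ (ρ j) ≡ stem α j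
        ρ-stem zero    = refl
        ρ-stem (suc j) = cong (α j ∷_) (ρ-stem j)

        α-branch : ∀ j → applyUpTo α j ∈ ⟦ S ⟧
        α-branch j
          with w , (u , w≡) , w∈V ← dne {∃[ w ] w ∈ Above V (proj₁ (ρ j))}
                 (λ ∄ → proj₂ (ρ j) ([] , λ w w∈ → contradiction (w , w∈) ∄))
          = WF.downwards-closed wf _ (reverse w)
              (reverse⇒⊑ {u = u} (begin
                reverse (reverse w)              ≡⟨ reverse-involutive w ⟩
                w                                ≡⟨ w≡ ⟩
                u ++ proj₁ (ρ j)                 ≡⟨ cong (u ++_) (ρ-stem j) ⟩
                u ++ stem α j                    ≡⟨ cong (u ++_) (reverse-applyUpTo α j) ⟨
                u ++ reverse (applyUpTo α j)     ∎))
              (V⊆S w∈V)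
          where open ≡-Reasoning

  -- Only finitely many elements above `r` are `r` itself or lie above one of its first `N`
  -- children.
  fanned-unbounded : ∀ {V r} → Fanned V r → ∀ N → ∃[ n ] N ≤ n × ∃[ u ] u ++ n ∷ r ∈ V
  fanned-unbounded {V} {r} (inf , fin) N = dne λ ∄ → inf (finite-⊆ (split-last ∄)
    (finite-∪ ([ r ] , λ _ → here) (finite-⋃< fin N)))
    where
    split-last : ¬ (∃[ n ] N ≤ n × ∃[ u ] u ++ n ∷ r ∈ V) → ∀ {w} → w ∈ Above V r →
                 w ≡ r ⊎ ∃[ n ] n < N × w ∈ Above V (n ∷ r)
    split-last ∄ ((u , refl) , w∈V) with initLast u
    ... | []       = inj₁ refl
    ... | u′ ∷ʳ′ n = inj₂ (n , ≰⇒> (λ N≤n → ∄ (n , N≤n , u′ , subst (_∈ V) assoc w∈V)) ,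
                           (u′ , assoc) , w∈V)
      where assoc = ++-assoc u′ [ n ] r

-- The dichotomy

record GapData : Set₁ where
  field
    ℬ            : Family ℕ
    ℬ⊆𝒫∞         : ℬ ⊆ 𝒫∞
    hereditary-ℬ : Hereditary ℬ
    measurable-ℬ : CMeasurable ℬ
    m-family-ℬ   : MFamily ℬ
    φ            : (ℕ → ℕ) → 2^ ℕ
    continuous-φ : Continuous φ

module Gap (em : ExcludedMiddle 0ℓ) (gap-data : GapData) where

  open GapData gap-data
  open Classical em

  -- Positive pairs as Ramsey conditions

  infix 4 _∈[_]
  _∈[_] : (ℕ → ℕ) → List ℕ → Set
  α ∈[ s ] = stem α (length s) ≡ s

  ∈[stem] : ∀ α n → α ∈[ stem α n ]
  ∈[stem] α n = cong (stem α) (length-stem α n)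

  ∈[]-stem : ∀ {α s n} → length s ≤ n → α ∈[ s ] → ∀ {β} → β ∈[ stem α n ] → β ∈[ s ]
  ∈[]-stem {α} {s} {n} s≤n α∈s {β} β∈ = trans (stem-shorter s≤n β≡α) α∈s
    where
    β≡α : stem β n ≡ stem α n
    β≡α = trans (cong (stem β) (sym (length-stem α n))) β∈

  Small : 2^ ℕ → Set
  Small D = ∀ B → B ∈ ℬ → D ⊥ B

  Uncovered : (α : ℕ → ℕ) (E D : 2^ ℕ) → Pred ℕ 0ℓ
  Uncovered α E D b = b ∈ ⟦ φ α ⟧ × b ∈ ⟦ E ⟧ × ¬ (b ∈ ⟦ D ⟧)

  Covers : (α : ℕ → ℕ) (E D : 2^ ℕ) → Set
  Covers α E D = Finite (Uncovered α E D)

  -- The sets φ α ∩ E, for α extending s, are countably generated in ℬ^⊥; finite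
  -- generators are harmless here, although 𝒫∞ excludes them from ℬ ^⊥.
  CG : List ℕ → 2^ ℕ → Set
  CG s E = Σ[ D ∈ (ℕ → 2^ ℕ) ] (∀ n → Small (D n)) × (∀ {α} → α ∈[ s ] → ∃[ n ] Covers α E (D n))

  -- Indexing generators by lists lets a pair of indices, or an index together with a stem, serve
  -- directly as an index.
  cg-by-lists : ∀ {s E} (D : List ℕ → 2^ ℕ) → (∀ l → Small (D l)) →
                (∀ {α} → α ∈[ s ] → ∃[ l ] Covers α E (D l)) → CG s E
  cg-by-lists {E = E} D small covers = D ∘ enum , small ∘ enum , λ {α} α∈s →
    let l , fin = covers α∈s
    in code l , subst (Covers α E ∘ D) (sym (enum-code l)) fin

  ∅ : 2^ ℕ
  ∅ _ = false

  small-∅ : Small ∅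
  small-∅ B _ = [] , λ { _ (() , _) }

  P : Set
  P = Σ[ s ∈ List ℕ ] Σ[ E ∈ 2^ ℕ ] ¬ CG s E

  path : P → List ℕ
  path = proj₁

  set : P → 2^ ℕ
  set = proj₁ ∘ proj₂

  infix 4 _≼_
  _≼_ : P → P → Set
  p ≼ q = length (path q) ≤ length (path p) ×
          (∀ {α} → α ∈[ path p ] → α ∈[ path q ]) ×
          (⟦ set p ⟧ ⊆ ⟦ set q ⟧)

  ≼-refl : ∀ {p} → p ≼ p
  ≼-refl = ≤-refl , id , id

  ≼-trans : ∀ {p q r} → p ≼ q → q ≼ r → p ≼ r
  ≼-trans (l , f , g) (l′ , f′ , g′) = ≤-trans l′ l , f′ ∘ f , g′ ∘ g

  opaque

    -- If both halves of `E` were countably generated, the pairwise unions of their generators would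
    -- serve `E`.
    split : ∀ p (R : Pred ℕ 0ℓ) → ∃[ p′ ] p′ ≼ p × (⟦ set p′ ⟧ ⊆ R ⊎ ⟦ set p′ ⟧ ⊆ ∁ R)
    split (s , E , ¬cg) R with em {CG s ⌊ ⟦ E ⟧ ∩ R ⌋} | em {CG s ⌊ ⟦ E ⟧ ∩ ∁ R ⌋}
    ... | no ¬cg₁ | _ =
          (s , _ , ¬cg₁) , (≤-refl , id , proj₁ ∘ ∈⌊⌋⁻) , inj₁ (proj₂ ∘ ∈⌊⌋⁻)
    ... | yes _ | no ¬cg₂ =
          (s , _ , ¬cg₂) , (≤-refl , id , proj₁ ∘ ∈⌊⌋⁻) , inj₂ (proj₂ ∘ ∈⌊⌋⁻)
    ... | yes (D₁ , small₁ , covers₁) | yes (D₂ , small₂ , covers₂) =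
          contradiction (cg-by-lists D small covers) ¬cg
      where
      D : List ℕ → 2^ ℕ
      D (m ∷ n ∷ []) = ⌊ (λ b → b ∈ ⟦ D₁ m ⟧ ⊎ b ∈ ⟦ D₂ n ⟧) ⌋
      D _            = ∅

      small : ∀ l → Small (D l)
      small []           = small-∅
      small (_ ∷ [])     = small-∅
      small (m ∷ n ∷ []) B B∈ = finite-⊆
        (λ (b∈D , b∈B) → Sum.map (_, b∈B) (_, b∈B) (∈⌊⌋⁻ b∈D))
        (finite-∪ (small₁ m B B∈) (small₂ n B B∈))
      small (_ ∷ _ ∷ _ ∷ _) = small-∅

      covers : ∀ {α} → α ∈[ s ] → ∃[ l ] Covers α E (D l)
      covers {α} α∈s with m , fin₁ ← covers₁ α∈s | n , fin₂ ← covers₂ α∈s =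
        m ∷ n ∷ [] , finite-⊆ either (finite-∪ fin₁ fin₂)
        where
        either : ∀ {b} → b ∈ Uncovered α E (D (m ∷ n ∷ [])) →
                 b ∈ Uncovered α ⌊ ⟦ E ⟧ ∩ R ⌋ (D₁ m) ⊎ b ∈ Uncovered α ⌊ ⟦ E ⟧ ∩ ∁ R ⌋ (D₂ n)
        either {b} (b∈φ , b∈E , b∉D) with em {R b}
        ... | yes b∈R = inj₁ (b∈φ , ∈⌊⌋⁺ (b∈E , b∈R) , b∉D ∘ ∈⌊⌋⁺ ∘ inj₁)
        ... | no b∉R  = inj₂ (b∈φ , ∈⌊⌋⁺ (b∈E , b∉R) , b∉D ∘ ∈⌊⌋⁺ ∘ inj₂)

  conditions : Conditions
  conditions = record
    { P       = P
    ; _≼_     = _≼_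
    ; ≼-refl  = λ {p} → ≼-refl {p}
    ; ≼-trans = λ {p} {q} {r} → ≼-trans {p} {q} {r}
    ; E       = ⟦_⟧ ∘ set
    ; E-mono  = proj₂ ∘ proj₂
    ; split   = split
    }

  open Ramsey em conditions

  -- Elements forced by positive pairs

  Forces : List ℕ → Pred ℕ 0ℓ
  Forces s b = ∀ α → α ∈[ s ] → b ∈ ⟦ φ α ⟧

  -- The elements of E forced by a condition below (s , E), of the form (s′ , E).
  Forced : P → Pred ℕ 0ℓ
  Forced (s , E , _) b = b ∈ ⟦ E ⟧ × ∃[ β ] ∃[ n ]
    length s < n × β ∈[ s ] × ¬ CG (stem β n) E × Forces (stem β n) b

  continuous⇒forces : ∀ {α b} → b ∈ ⟦ φ α ⟧ → ∃[ N ] (∀ {n} → N ≤ n → Forces (stem α n) b)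
  continuous⇒forces {α} {b} b∈φα
    with xs , near ← continuous-φ α [ b ]
    with N , xs<N ← bound xs
    = N , λ {n} N≤n β β∈ →
      let β≡α = trans (cong (stem β) (sym (length-stem α n))) β∈
          agree = near β (All.tabulate λ x∈xs → sym (stem-injective β≡α (<-≤-trans (xs<N x∈xs) N≤n)))
      in trans (sym (All.head agree)) b∈φα

  -- Were the forced set small, it and the generators for all non-positive `(s′ , E)` would generate
  -- `(s , E)`. If some stem of `α` longer than `s` is non-positive, its generators cover `φ α`; if
  -- none is, continuity makes every element of `φ α ∩ E` forced.
  forced-not-small : ∀ p → ¬ Small ⌊ Forced p ⌋
  forced-not-small p@(s , E , ¬cg) small-forced = ¬cg (cg-by-lists D small covers)
    where
    generators : ∀ {s} → Dec (CG s E) → ℕ → 2^ ℕ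
    generators (yes (D , _)) = D
    generators (no _)        = λ _ → ∅

    small-generators : ∀ {s} (cg? : Dec (CG s E)) m → Small (generators cg? m)
    small-generators (yes (_ , small , _)) = small
    small-generators (no _)                = λ _ → small-∅

    covers-generators : ∀ {s α} (cg? : Dec (CG s E)) → CG s E → α ∈[ s ] →
                        ∃[ m ] Covers α E (generators cg? m)
    covers-generators (yes (_ , _ , covers)) _  α∈s = covers α∈s
    covers-generators (no ¬cg)               cg _   = contradiction cg ¬cg

    D : List ℕ → 2^ ℕ
    D []      = ⌊ Forced p ⌋
    D (m ∷ s) = generators {s} em m

    small : ∀ l → Small (D l)
    small []      = small-forced
    small (m ∷ s) = small-generators {s} em m

    covers : ∀ {α} → α ∈[ s ] → ∃[ l ] Covers α E (D l)
    covers {α} α∈s with em {∃[ n ] length s < n × CG (stem α n) E}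
    ... | yes (n , _ , cg) with m , fin ← covers-generators em cg (∈[stem] α n) =
          m ∷ stem α n , fin
    ... | no ∄ = [] , [] , λ b (b∈φ , b∈E , unforced) →
          let N , forces = continuous⇒forces b∈φ
              n          = suc (length s) ⊔ N
              s<n        = m≤m⊔n (suc (length s)) N
          in contradiction
               (∈⌊⌋⁺ (b∈E , α , n , s<n , α∈s , (λ cg → ∄ (n , s<n , cg)) ,
                      forces (m≤n⊔m (suc (length s)) N)))
               unforced

  opaque

    forced-in-ℬ : ∀ p → ∃[ B ] B ∈ ℬ × ⟦ B ⟧ ⊆ Forced p
    forced-in-ℬ p with em {∃[ B ] B ∈ ℬ × ¬ ⌊ Forced p ⌋ ⊥ B}
    ... | no ∄ = contradiction (λ B B∈ → dne λ inf → ∄ (B , B∈ , inf)) (forced-not-small p)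
    ... | yes (B , B∈ , inf) =
          ⌊ ⟦ ⌊ Forced p ⌋ ⟧ ∩ ⟦ B ⟧ ⌋ ,
          hereditary-ℬ B _ B∈ (inf ∘ finite-⊆ ∈⌊⌋⁺) (proj₂ ∘ ∈⌊⌋⁻) ,
          ∈⌊⌋⁻ ∘ proj₁ ∘ ∈⌊⌋⁻

  -- A condition with a number it forces. `branch` runs through its path, and limits along chains
  -- are read off from it.
  record Node : Set where
    no-eta-equality
    field
      cond    : P
      value   : ℕ
      branch  : ℕ → ℕ
      branch∈ : branch ∈[ path cond ]
      value∈  : value ∈ ⟦ set cond ⟧
      forces  : Forces (path cond) value
  open Node

  opaque

    advance : ∀ p N → Σ[ x ∈ Node ]
              cond x ≼ p × length (path p) < length (path (cond x)) × N ≤ value x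
    advance p@(s , E , _) N
      with B , B∈ℬ , B⊆ ← forced-in-ℬ p
      with b , N≤b , b∈B ← infinite⇒unbounded (ℬ⊆𝒫∞ B∈ℬ) N
      with b∈E , β , n , s<n , β∈s , ¬cg , forces ← B⊆ b∈B
      = record { cond = stem β n , E , ¬cg ; value = b ; branch = β ; branch∈ = ∈[stem] β n
               ; value∈ = b∈E ; forces = forces } ,
        (<⇒≤ s<|stem| , ∈[]-stem (<⇒≤ s<n) β∈s , id) , s<|stem| , N≤b
      where
      s<|stem| : length s < length (stem β n)
      s<|stem| = subst (length s <_) (sym (length-stem β n)) s<n

  -- A colour depending on tails only, since a stem may contain numbers unrelated to ℬ.
  InSomeTail : Pred (ℕ → ℕ) 0ℓ
  InSomeTail Y = ∃[ k ] tail k Y ∈ ℬ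

  -- Take members of `ℬ` forced at the `q i`. Their diagonal set `A` meets the steps of `q` beyond
  -- every bound, so a sequence can run through `A` after its stem, and by heredity a tail of it is
  -- in `ℬ`.
  not-outside : ∀ {a q} → ¬ Outside InSomeTail a q
  not-outside {a} {q} outside =
    let A , A∈ℬ , A-diag = MFamily.diagonal m-family-ℬ
          (λ i → proj₁ (forced-in-ℬ (q i))) (λ i → proj₁ (proj₂ (forced-in-ℬ (q i))))
        y , y∈A , _ , Y∈⟨⟩ = thread {a} {q} {⟦ A ⟧} (pick A∈ℬ A-diag)
        -- Cutting at a bound of the stem removes the entries that may lie outside `A`.
        N , a<N = bound a
    in outside _ Y∈⟨⟩
         (N , hereditary-ℬ A _ A∈ℬ (∈-tail-infinite N {a = a} {q} Y∈⟨⟩) (tail⊆A {A} {y} y∈A Y∈⟨⟩ a<N))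
    where
    pick : ∀ {A} → A ∈ ℬ →
           (∀ k → Finite (⟦ A ⟧ ∖ (λ x → ∃[ i ] k ≤ i × x ∈ ⟦ proj₁ (forced-in-ℬ (q i)) ⟧))) →
           ∀ k → ∃[ b ] b ∈ Steps q k × b ∈ ⟦ A ⟧
    pick {A} A∈ℬ A-diag k =
      let b , k≤b , b∈A , i , k≤i , b∈ = infinite⇒unbounded
            (λ fin → ℬ⊆𝒫∞ A∈ℬ (finite-⊆ meets-or-not (finite-∪ fin (A-diag k)))) k
      in b , (k≤b , i , k≤i , proj₁ (proj₂ (proj₂ (forced-in-ℬ (q i))) b∈)) , b∈A
      where
      U : Pred ℕ 0ℓ
      U x = ∃[ i ] k ≤ i × x ∈ ⟦ proj₁ (forced-in-ℬ (q i)) ⟧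

      meets-or-not : ∀ {x} → x ∈ ⟦ A ⟧ → (x ∈ ⟦ A ⟧ × x ∈ U) ⊎ (x ∈ ⟦ A ⟧ × ¬ (x ∈ U))
      meets-or-not {x} x∈A with em {x ∈ U}
      ... | yes x∈U = inj₁ (x∈A , x∈U)
      ... | no x∉U  = inj₂ (x∈A , x∉U)

    tail⊆A : ∀ {A y N} → (∀ j → y j ∈ ⟦ A ⟧) → prepend a y ∈⟨ a , q ⟩ →
             (∀ {x} → x List.∈ a → x < N) → ⟦ tail N (prepend a y) ⟧ ⊆ ⟦ A ⟧
    tail⊆A {A} {y} y∈A (eq , _) a<N x∈ with N≤x , j , refl ← ∈⌊⌋⁻ x∈ with j <? length a
    ... | yes j<a = contradiction N≤x
          (<⇒≱ (a<N (subst (prepend a y j List.∈_) eq (∈-applyDownFrom⁺ (prepend a y) j<a))))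
    ... | no j≮a with i ← j ∸ length a | refl ← sym (m∸n+n≡m (≮⇒≥ j≮a)) =
          subst (_∈ ⟦ A ⟧) (sym (prepend-lookup a y i)) (y∈A i)

  -- Homogeneous fans and the children of a node

  measurable-in-some-tail : Measurable InSomeTail
  measurable-in-some-tail = measurable-⋃ (measurable-tail measurable-ℬ)

  record Fan (p : P) : Set where
    no-eta-equality
    field
      a      : List ℕ
      q      : Seq
      below  : ∀ {i} → next a ≤ i → q i ≼ p
      inside : Inside InSomeTail a q

  opaque

    -- The Ramsey theorem is applied to the constant sequence `p`; `not-outside` excludes the other
    -- colour.
    fan : ∀ p → Fan p
    fan p with measurable-in-some-tail {[]} (here refl) (λ _ → p)
    ... | a , q , _ , q≤p , inj₁ inside  =
          record { a = a ; q = q ; below = λ a≤i → proj₂ (proj₂ (q≤p _ a≤i)) ; inside = inside }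
    ... | a , q , _ , _   , inj₂ outside = contradiction outside (not-outside {a} {q})

  -- A sequence threaded through `R` has a tail in `ℬ`; discarding what comes only from the stem
  -- leaves an infinite subset of `R`.
  fan-in-ℬ : ∀ {p} (F : Fan p) {R : Pred ℕ 0ℓ} →
             (∀ k → ∃[ b ] b ∈ Steps (Fan.q F) k × b ∈ R) → ∃[ B ] B ∈ ℬ × ⟦ B ⟧ ⊆ R
  fan-in-ℬ F {R} pick
    with y , y∈R , j≤y , Y∈⟨⟩ ← thread {Fan.a F} {Fan.q F} pick
    with k , tail∈ℬ ← Fan.inside F (prepend (Fan.a F) y) Y∈⟨⟩
    = tail k y ,
      hereditary-ℬ _ _ tail∈ℬ (tail-infinite k (λ N → N , j≤y N))
        (λ x∈ → let k≤x , j , eq = ∈⌊⌋⁻ x∈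
                in ∈⌊⌋⁺ (k≤x , j + length (Fan.a F) , trans (prepend-lookup (Fan.a F) y j) eq)) ,
      (λ x∈ → let _ , j , eq = ∈⌊⌋⁻ x∈ in subst (_∈ R) eq (y∈R j))

  -- The index into the fan grows with `m`, since `Steps` asks for arbitrarily late entries.
  -- Starting at `next (Fan.a F)` keeps children below their parent.
  child : Node → ℕ → Node
  child x m = proj₁ (advance (Fan.q F (next (Fan.a F) + m)) m)
    where F = fan (cond x)

  module _ (x : Node) (m : ℕ) where

    private
      F = fan (cond x)
      i = next (Fan.a F) + m

    child-≼-fan : cond (child x m) ≼ Fan.q F i
    child-≼-fan = proj₁ (proj₂ (advance (Fan.q F i) m))

    child-≼ : cond (child x m) ≼ cond x
    child-≼ = ≼-trans {cond (child x m)} {Fan.q F i} {cond x} child-≼-fan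
                (Fan.below F (m≤m+n (next (Fan.a F)) m))

    child-value : m ≤ value (child x m)
    child-value = proj₂ (proj₂ (proj₂ (advance (Fan.q F i) m)))

    child-longer : length (path (cond x)) < length (path (cond (child x m)))
    child-longer = ≤-<-trans (proj₁ (Fan.below F (m≤m+n (next (Fan.a F)) m)))
                     (proj₁ (proj₂ (proj₂ (advance (Fan.q F i) m))))

  -- The embedding of the tree

  module Embedding (root : Node) where

    -- Sequences of naturals are read from their last entry to the first.
    node : List ℕ → Node
    node []      = root
    node (m ∷ a) = child (node a) m

    limit : ℕ → ℕ
    limit n = proj₁ (bound (map (value ∘ node) (stems n)))

    value<limit : ∀ {a} n → a List.∈ stems n → value (node a) < limit n
    value<limit n a∈ =
      proj₂ (bound (map (value ∘ node) (stems n))) (∈-map⁺ (value ∘ node) a∈)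

    -- So sparse that value (place r) lies between h (code r) and h (suc (code r)).
    h : ℕ → ℕ
    h zero    = 0
    h (suc c) = suc (h c) ⊔ limit (suc (h c))

    h-<-suc : ∀ c → h c < h (suc c)
    h-<-suc c = m≤m⊔n (suc (h c)) (limit (suc (h c)))

    h-mono : ∀ {c d} → c ≤′ d → h c ≤ h d
    h-mono ≤′-refl       = ≤-refl
    h-mono {d = suc d} (≤′-step c≤d) = ≤-trans (h-mono c≤d) (<⇒≤ (h-<-suc d))

    c≤h : ∀ c → c ≤ h c
    c≤h zero    = z≤n
    c≤h (suc c) = ≤-trans (s≤s (c≤h c)) (h-<-suc c)

    -- Child `n` of `r` becomes child number `h (code (n ∷ r))`, so values increase with the code
    -- and the map is injective.
    position : List ℕ → List ℕ
    position []      = []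
    position (n ∷ r) = h (code (n ∷ r)) ∷ position r

    next-position : ∀ r → next (position r) ≤ suc (h (code r))
    next-position []      = z≤n
    next-position (n ∷ r) = ≤-refl

    valid-position : ∀ r → Valid (position r)
    valid-position []      = here refl
    valid-position (n ∷ r) = valid-∷
      (≤-trans (next-position r) (≤-trans (h-<-suc (code r)) (h-mono (≤⇒≤′ (code-<-∷ n r)))))
      (valid-position r)

    place : List ℕ → Node
    place = node ∘ position

    h≤value : ∀ r → h (code r) ≤ value (place r)
    h≤value []      = z≤n
    h≤value (n ∷ r) = child-value (place r) (h (code (n ∷ r)))

    value<h : ∀ r → value (place r) < h (suc (code r))
    value<h r = <-≤-trans
      (value<limit (suc (h (code r))) (stems-mono (≤⇒≤′ (next-position r)) (valid-position r)))
      (m≤n⊔m (suc (h (code r))) (limit (suc (h (code r)))))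

    value-<-mono : ∀ {r s} → code r < code s → value (place r) < value (place s)
    value-<-mono {r} {s} r<s =
      <-≤-trans (value<h r) (≤-trans (h-mono (≤⇒≤′ r<s)) (h≤value s))

    value-injective : ∀ {r s} → value (place r) ≡ value (place s) → r ≡ s
    value-injective {r} {s} eq with <-cmp (code r) (code s)
    ... | tri< r<s _ _ = contradiction eq (<⇒≢ (value-<-mono {r} {s} r<s))
    ... | tri≈ _ r≡s _ = code-injective r≡s
    ... | tri> _ _ r>s = contradiction (sym eq) (<⇒≢ (value-<-mono {s} {r} r>s))

    place-≼ : ∀ u r → cond (place (u ++ r)) ≼ cond (place r)
    place-≼ []      r = ≼-refl {cond (place r)}
    place-≼ (n ∷ u) r =
      ≼-trans {cond (place (n ∷ u ++ r))} {cond (place (u ++ r))} {cond (place r)}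
        (child-≼ (place (u ++ r)) _) (place-≼ u r)

    place-longer : ∀ r → length r ≤ length (path (cond (place r)))
    place-longer []      = z≤n
    place-longer (n ∷ r) = ≤-<-trans (place-longer r) (child-longer (place r) _)

    opaque

      at : ℕ^<ℕ → Node
      at t = place (reverse t)

      at-injective : ∀ {s t} → value (at s) ≡ value (at t) → s ≡ t
      at-injective eq = reverse-injective (value-injective eq)

      at-longer : ∀ t → length t ≤ length (path (cond (at t)))
      at-longer t = subst (_≤ length (path (cond (at t)))) (length-reverse t) (place-longer (reverse t))

      at-≼ : ∀ {s t} → s ⊑ t → cond (at t) ≼ cond (at s)
      at-≼ {s} {t} s⊑t = let u , eq = ⊑⇒reverse s⊑t in
        subst (λ r → cond (place r) ≼ cond (at s)) (sym eq) (place-≼ u (reverse s))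

      value-at : ∀ t → value (at t) ≡ value (place (reverse t))
      value-at t = refl

    ψ : ℕ^<ℕ → ℕ
    ψ t = value (at t)

    ψ-injective : Injective _≡_ _≡_ ψ
    ψ-injective = at-injective

    opaque

      -- Elements of the fan above child `n` have values in the set of an entry of the fan's
      -- sequence, and the index of that entry grows with `n`. A sequence of steps can therefore be
      -- threaded through them.
      fanned⇒in-ℬ : ∀ {V} {R : Pred ℕ 0ℓ} {r} → Trees.Fanned em V r →
                    (∀ {w} → w ∈ V → value (place w) ∈ R) →
                    ∃[ B ] B ∈ ℬ × ⟦ B ⟧ ⊆ R
      fanned⇒in-ℬ {V} {R} {r} fanned V⊆R = fan-in-ℬ F pick
        where
        F : Fan (cond (place r))
        F = fan (cond (place r))

        pick : ∀ k → ∃[ b ] b ∈ Steps (Fan.q F) k × b ∈ R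
        pick k with n , k≤n , u , w∈V ← Trees.fanned-unbounded em fanned k =
          value (place w) , (k≤value , i , k≤i , value∈q) , V⊆R w∈V
          where
          w : List ℕ
          w = u ++ n ∷ r

          m i : ℕ
          m = h (code (n ∷ r))
          i = next (Fan.a F) + m

          k≤c : k ≤ code (n ∷ r)
          k≤c = ≤-trans k≤n (n≤code-∷ n r)

          k≤i : k ≤ i
          k≤i = ≤-trans k≤c (≤-trans (c≤h _) (m≤n+m m (next (Fan.a F))))

          k≤value : k ≤ value (place w)
          k≤value = ≤-trans k≤c (≤-trans (code-≤-++ u (n ∷ r)) (≤-trans (c≤h _) (h≤value w)))

          value∈q : value (place w) ∈ ⟦ set (Fan.q F i) ⟧
          value∈q = proj₂ (proj₂ (child-≼-fan (place r) m))
            (proj₂ (proj₂ (place-≼ u (n ∷ r))) (value∈ (place w)))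

    chain-branch : ∀ {C} → C ∈ 𝒞 → ∃[ α ] (∀ {t} → t ∈ ⟦ C ⟧ → ψ t ∈ ⟦ φ α ⟧)
    chain-branch {C} C∈𝒞@(_ , chain) = α , λ {t} t∈C → forces (at t) α (α∈ t∈C)
      where
      long : ∀ i → ∃[ t ] t ∈ ⟦ C ⟧ × i ≤ length t
      long = Trees.chain-unbounded em C∈𝒞

      α : ℕ → ℕ
      -- The path at a node is at least as long as the sequence placed there, so any element of
      -- length above `i` settles entry `i`.
      α i = branch (at (proj₁ (long (suc i)))) i

      branch-agree : ∀ {s t i} → s ⊑ t → i < length (path (cond (at s))) →
                     branch (at s) i ≡ branch (at t) i
      branch-agree {s} {t} s⊑t = stem-injective (trans (branch∈ (at s))
        (sym (proj₁ (proj₂ (at-≼ {s} {t} s⊑t)) (branch∈ (at t)))))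

      α∈ : ∀ {t} → t ∈ ⟦ C ⟧ → α ∈[ path (cond (at t)) ]
      α∈ {t} t∈C = trans (stem-cong _ agree) (branch∈ (at t))
        where
        agree : ∀ {i} → i < length (path (cond (at t))) → α i ≡ branch (at t) i
        agree {i} i<t = via (long (suc i)) refl
          where
          via : ((s , _) : ∃[ s ] s ∈ ⟦ C ⟧ × suc i ≤ length s) →
                    α i ≡ branch (at s) i → α i ≡ branch (at t) i
          via (s , s∈C , i<s) eq = trans eq (agree-at (chain s t s∈C t∈C))
            where
            below⊑ : s ⊑ t → branch (at s) i ≡ branch (at t) i
            below⊑ s⊑t = branch-agree {s} {t} s⊑t (<-≤-trans i<s (at-longer s))

            below⊒ : t ⊑ s → branch (at s) i ≡ branch (at t) i
            below⊒ t⊑s = sym (branch-agree {t} {s} t⊑s i<t)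

            agree-at : s ⊑ t ⊎ t ⊑ s → branch (at s) i ≡ branch (at t) i
            agree-at (inj₁ s⊑t) = below⊑ s⊑t
            agree-at (inj₂ t⊑s) = below⊒ t⊑s

    image : 2^ ℕ^<ℕ → 2^ ℕ
    image T = ⌊ (λ x → ∃[ t ] t ∈ ⟦ T ⟧ × ψ t ≡ x) ⌋

    image-infinite : ∀ {T} → T ∈ 𝒫∞ → image T ∈ 𝒫∞
    image-infinite T∈ = infinite-image ψ-injective T∈ ∘ finite-⊆ ∈⌊⌋⁺

    preimage-image : ∀ T t → T t ≡ image T (ψ t)
    preimage-image T t = ⟦⟧-ext T (image T) (λ t∈T → ∈⌊⌋⁺ (t , t∈T , refl)) back
      where
      back : ψ t ∈ ⟦ image T ⟧ → t ∈ ⟦ T ⟧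
      back ψt∈ = let s , s∈T , eq = ∈⌊⌋⁻ ψt∈ in subst (_∈ ⟦ T ⟧) (ψ-injective eq) s∈T

    chains⊆ : ∀ {𝒜} → Hereditary 𝒜 → (∀ α → φ α ∈ 𝒜) → 𝒞 ⊆ Preimages ψ 𝒜
    chains⊆ hereditary-𝒜 φ∈𝒜 {C} C∈𝒞@(infinite , _) =
      let α , ψ∈φα = chain-branch C∈𝒞
      in image C ,
         hereditary-𝒜 (φ α) (image C) (φ∈𝒜 α) (image-infinite {C} infinite)
           (λ x∈ → let t , t∈C , eq = ∈⌊⌋⁻ x∈ in subst (_∈ ⟦ φ α ⟧) eq (ψ∈φα t∈C)) ,
         preimage-image C

    -- An infinite intersection of the image with some `D` in `ℬ ^⊥` would pull back to an infinite
    -- subset of a well-founded tree. A fan in it gives a member of `ℬ` inside `D`, contradicting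
    -- orthogonality.
    wf⊆ : I-wf ⊆ Preimages ψ ((ℬ ^⊥) ^⊥)
    wf⊆ {W} (infinite , S , wf , W⊆S) =
      image W , (image-infinite {W} infinite , λ D D∈ℬ^⊥ → dne (not-infinite D D∈ℬ^⊥)) ,
      preimage-image W
      where
      not-infinite : ∀ D → D ∈ ℬ ^⊥ → ¬ ¬ Finite (⟦ image W ⟧ ∩ ⟦ D ⟧)
      not-infinite D (_ , D⊥ℬ) inf =
        let r , fanned = Trees.wf⇒fanned em {V = V} wf (W⊆S ∘ proj₁)
                           (λ fin → inf (finite-⊆ pull-back (finite-image (value ∘ place) fin)))
            B , B∈ℬ , B⊆D = fanned⇒in-ℬ {V} {⟦ D ⟧} {r} fanned proj₂
        in ℬ⊆𝒫∞ B∈ℬ (finite-⊆ (λ b∈B → B⊆D b∈B , b∈B) (D⊥ℬ B B∈ℬ))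
        where
        V : Pred (List ℕ) 0ℓ
        V r = reverse r ∈ ⟦ W ⟧ × value (place r) ∈ ⟦ D ⟧

        pull-back : ∀ {x} → x ∈ ⟦ image W ⟧ × x ∈ ⟦ D ⟧ → ∃[ r ] r ∈ V × value (place r) ≡ x
        pull-back (x∈ , x∈D) =
          let t , t∈W , eq = ∈⌊⌋⁻ x∈
              place≡ = trans (sym (value-at t)) eq
          in reverse t ,
             (subst (_∈ ⟦ W ⟧) (sym (reverse-involutive t)) t∈W ,
              subst (_∈ ⟦ D ⟧) (sym place≡) x∈D) ,
             place≡

  -- From positive pairs to the two alternatives

  full : 2^ ℕ
  full _ = true

  -- `J` keeps the infinite generators; a finite one cannot almost contain an infinite `A`.
  cg⇒countablyGenerated : ∀ {𝒜 : Family ℕ} → 𝒜 ⊆ 𝒫∞ → (∀ {A} → A ∈ 𝒜 → ∃[ α ] A ≗ φ α) →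
                          CG [] full → 𝒜 CountablyGeneratedIn (ℬ ^⊥)
  cg⇒countablyGenerated {𝒜} 𝒜⊆𝒫∞ param (D , small , covers) =
    ⌊ (λ n → D n ∈ 𝒫∞) ⌋ , D , (λ n n∈J → ∈⌊⌋⁻ n∈J , small n) , generated
    where
    generated : ∀ A → A ∈ 𝒜 → ∃[ n ] n ∈ ⟦ ⌊ (λ n → D n ∈ 𝒫∞) ⌋ ⟧ × Finite (⟦ A ⟧ ∖ ⟦ D n ⟧)
    generated A A∈𝒜 =
      let α , A≗φα    = param A∈𝒜
          n , covered = covers {α} refl
          fin         = finite-⊆ (λ {x} (x∈A , x∉D) → trans (sym (A≗φα x)) x∈A , refl , x∉D) covered
      in n , ∈⌊⌋⁺ (λ fin-D → 𝒜⊆𝒫∞ A∈𝒜 (finite-⊆ in-or-out (finite-∪ fin fin-D))) , fin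
      where
      in-or-out : ∀ {n x} → x ∈ ⟦ A ⟧ → (x ∈ ⟦ A ⟧ × ¬ (x ∈ ⟦ D n ⟧)) ⊎ x ∈ ⟦ D n ⟧
      in-or-out {n} {x} x∈A with em {x ∈ ⟦ D n ⟧}
      ... | yes x∈D = inj₂ x∈D
      ... | no x∉D  = inj₁ (x∈A , x∉D)

mainTheorem2 : (∀ {ℓ} → ExcludedMiddle ℓ) →
    (𝒜 ℬ : Family ℕ) →
    𝒜 ⊆ 𝒫∞ → ℬ ⊆ 𝒫∞ →
    Hereditary 𝒜 → Hereditary ℬ →
    𝒜 ⊥ᶠ ℬ →
    Analytic 𝒜 →
    CMeasurable ℬ → MFamily ℬ →
    (𝒜 CountablyGeneratedIn (ℬ ^⊥))
    ⊎ (Σ[ ψ ∈ (ℕ^<ℕ → ℕ) ]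
    Injective _≡_ _≡_ ψ ×
    𝒞 ⊆ Preimages ψ 𝒜 ×
    I-wf ⊆ Preimages ψ ((ℬ ^⊥) ^⊥))
mainTheorem2 em 𝒜 ℬ _ _ _ _ _ (inj₁ 𝒜-empty) _ _ =
  -- For empty `𝒜` the index set `J` is taken empty, so no member of `ℬ ^⊥` has to be exhibited.
  inj₁ ((λ _ → false) , (λ _ _ → false) , (λ _ ()) , λ A A∈𝒜 → contradiction A∈𝒜 (𝒜-empty A))
mainTheorem2 em 𝒜 ℬ 𝒜⊆𝒫∞ ℬ⊆𝒫∞ hereditary-𝒜 hereditary-ℬ _
  (inj₂ (φ , continuous-φ , 𝒜⊆φ , φ⊆𝒜)) measurable-ℬ m-family-ℬ = dichotomy em
  where
  gap-data : GapData
  gap-data = record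
    { ℬ            = ℬ
    ; ℬ⊆𝒫∞         = ℬ⊆𝒫∞
    ; hereditary-ℬ = hereditary-ℬ
    ; measurable-ℬ = measurable-ℬ
    ; m-family-ℬ   = m-family-ℬ
    ; φ            = φ
    ; continuous-φ = continuous-φ
    }

  open Gap em gap-data

  dichotomy : Dec (CG [] full) →
              (𝒜 CountablyGeneratedIn (ℬ ^⊥)) ⊎
              (Σ[ ψ ∈ (ℕ^<ℕ → ℕ) ] Injective _≡_ _≡_ ψ ×
                 𝒞 ⊆ Preimages ψ 𝒜 × I-wf ⊆ Preimages ψ ((ℬ ^⊥) ^⊥))
  dichotomy (yes cg) = inj₁ (cg⇒countablyGenerated 𝒜⊆𝒫∞ 𝒜⊆φ cg)
  dichotomy (no ¬cg) = inj₂
    (ψ , ψ-injective , chains⊆ hereditary-𝒜 (λ α → φ⊆𝒜 (α , λ _ → refl)) , wf⊆)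
    where open Embedding (proj₁ (advance ([] , full , ¬cg) 0))
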